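{- Let $X$ be a homogeneously self-similar graph of bounded geometry, with length scaling factor $\nu$ and volume scaling factor $\mu$. Then the lower and upper global growth dimensions of $X$ are $$\underline{\dim}_G X=\overline{\dim}_G X=\frac{\log\mu}{\log\nu}.$$
   Context: Graph $X$ with vertex set $VX$ and edge set $EX$ is connected, locally finite, infinite, without loops or multiple edges. $d_X$ is the graph distance (length of a shortest path) and $\deg_X x$ the number of neighbours of $x$ in $X$. For $C\subset VX$, the boundary $\theta C$ is the set of vertices in $VX\setminus C$ adjacent to some vertex of $C$; the closure is $\overline{C}=C\cup\theta C$; $\hat C$ is the subgraph of $X$ spanned (induced) by $\overline{C}$. For $F\subset VX$, $\mathcal{C}_XF$ denotes the set of connected components of $VX\setminus F$ (as vertex sets). The reduced graph $X_F$ has vertex set $F$, and two (distinct) vertices $x,y\in F$ are adjacent in $X_F$ iff there is $C\in\mathcal{C}_XF$ with $x,y\in\theta C$. $X$ is self-similar with respect to $F\subset VX$ and $\psi:VX\to F$ if: (F1) no two vertices of $F$ are adjacent in $X$; (F2) the intersection of the closures of two different components in $\mathcal{C}_XF$ contains at most one vertex; (F3) $\psi$ is a graph isomorphism from $X$ to $X_F$. Put $F^0=VX$, $F^n=\psi^n(VX)$ (so $F^1=F$). Elements of $\mathcal{C}_XF^n$ are called $n$-cells; $1$-cells are called cells. A self-similar graph $X$ is homogeneously self-similar if: (H1) all cell graphs $\hat C$ ($C\in\mathcal{C}_XF$) are finite and for any cells $C,D$ there is a graph isomorphism $\alpha:\hat C\to\hat D$ with $\alpha(\theta C)=\theta D$;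 (H2) for every cell $C$ and $v_1,v_2,v_3,v_4\in\theta C$ with $v_1\neq v_2$, $v_3\ne v_4$, one has $d_X(v_1,v_2)=d_X(v_3,v_4)$. The length scaling factor $\nu$ is the $d_X$-distance of two different vertices in the boundary of a cell; the volume scaling factor $\mu$ is the number of cells contained in a $2$-cell (these do not depend on the choices). $X$ has bounded geometry if the set of its vertex degrees is bounded. Growth: $B(x,r)=\{y\in VX: d_X(y,x)\le r\}$ for $x\in VX$, $r\in\mathbb{N}_0$; for $A\subset VX$, $\mathrm{Vol}_X A=\sum_{y\in A}\deg_X y$; $V_x(r)=\mathrm{Vol}_X B(x,r)$; $\underline{V}(r)=\inf\{V_x(r): x\in VX\}$, $\overline{V}(r)=\sup\{V_x(r): x\in VX\}$. The global growth dimensions are $$\underline{\dim}_GX=\liminf_{r\to\infty}\frac{\log\underline{V}(r)}{\log r},\qquad \overline{\dim}_GX=\limsup_{r\to\infty}\frac{\log\overline{V}(r)}{\log r}.$$ -}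

module Defs where

open import Data.Integer.Base as ℤ using (+_; -[1+_]; +<+)
import Data.Integer.Properties as ℤ
open import Data.List.Base using (List; length; map; sum)
import Data.List.Membership.Setoid as Membership
import Data.List.Relation.Unary.Unique.Setoid as Uniqueness
open import Data.Nat.Base as ℕ using (ℕ; zero; suc; NonTrivial)
import Data.Nat.Properties as ℕ
open import Data.Nat.Tactic.RingSolver using (solve-∀)
open import Data.Product using (∃; ∃₂; _×_; _,_; proj₁; proj₂)
open import Data.Rational.Unnormalised as ℚ
  using (ℚᵘ; mkℚᵘ; 0ℚᵘ; *≤*; *<*; _<_; _≤_; _*_; _-_; _+_; 1/_)
import Data.Rational.Unnormalised.Properties as ℚ
open import Data.Unit using (⊤; tt)
open import Function.Base using (flip)
open import Function.Bundles using (_⇔_)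
open import Level using (Level; 0ℓ; _⊔_) renaming (suc to lsuc)
open import Relation.Binary.Bundles using (Setoid)
open import Relation.Binary.Construct.Closure.ReflexiveTransitive using (Star; ε; _◅_; _◅◅_)
open import Relation.Binary.Core using (Rel)
open import Relation.Binary.PropositionalEquality
  using (_≡_; _≢_; refl; sym; trans; cong; subst; subst₂; setoid)
open import Relation.Nullary using (¬_)
open import Relation.Nullary.Negation using (contradiction)
open import Relation.Unary using (Pred; U; ∁; _≐_; _⊆_; _∪_)
open import Relation.Unary.Relation.Binary.Equality using (≐-setoid)

module _ {c e : Level} (S : Setoid c e) where
  open Setoid S using (Carrier)
  open Membership S using (_∈_)
  open Uniqueness S using (Unique)

  Enumerates : ∀ {p} → List Carrier → Pred Carrier p → Set (c ⊔ e ⊔ p)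
  Enumerates xs P = Unique xs × (∀ x → P x ⇔ x ∈ xs)

  Finite : ∀ {p} → Pred Carrier p → Set (c ⊔ e ⊔ p)
  Finite P = ∃ λ xs → Enumerates xs P

  HasCardinality : ∀ {p} → Pred Carrier p → ℕ → Set (c ⊔ e ⊔ p)
  HasCardinality P n = ∃ λ xs → Enumerates xs P × length xs ≡ n

IsInf : ∀ {a p r} {A : Set a} → Rel A r → Pred A p → A → Set (a ⊔ p ⊔ r)
IsInf _≲_ P m = (∀ {a} → P a → m ≲ a) × (∀ b → (∀ {a} → P a → b ≲ a) → b ≲ m)

IsSup : ∀ {a p r} {A : Set a} → Rel A r → Pred A p → A → Set (a ⊔ p ⊔ r)
IsSup _≲_ = IsInf (flip _≲_)

Image : ∀ {a b p} {A : Set a} {B : Set b} → (A → B) → Pred A p → Pred B (a ⊔ b ⊔ p)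
Image f P y = ∃ λ x → P x × y ≡ f x

-- Classical Dedekind reals: x is given by the open initial segment
-- { q ∣ q < x }, so that x ≤ y is inclusion.  No locatedness is imposed;
-- under excluded middle it is automatic.

record ℝ : Set₁ where
  field
    below     : Pred ℚᵘ 0ℓ
    inhabited : ∃ λ q → below q
    bounded   : ∃ λ q → ¬ below q
    closed    : ∀ {p q} → p ≤ q → below q → below p
    rounded   : ∀ {p} → below p → ∃ λ q → p < q × below q

open ℝ public using (below)

infix 4 _≤ᵣ_

_≤ᵣ_ : Rel ℝ 0ℓ
x ≤ᵣ y = below x ⊆ below y

record Positive (x : ℝ) : Set where
  constructor positive
  field 0<x : below x 0ℚᵘ

module Logarithm (n : ℕ) where
  open ℕ.≤-Reasoning

  -- p/d < log₂ n  iff  2ᵖ < nᵈ.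
  belowLog : Pred ℚᵘ 0ℓ
  belowLog (mkℚᵘ (+ p)    d-1) = 2 ℕ.^ p ℕ.< n ℕ.^ suc d-1
  belowLog (mkℚᵘ -[1+ _ ] _)   = ⊤

  n<2^n : ∀ m → m ℕ.< 2 ℕ.^ m
  n<2^n zero    = ℕ.s≤s ℕ.z≤n
  n<2^n (suc m) = begin-strict
    suc m                   ≡⟨ ℕ.+-comm 1 m ⟩
    m ℕ.+ 1                 <⟨ ℕ.+-mono-<-≤ (n<2^n m) (ℕ.m^n>0 2 m) ⟩
    2 ℕ.^ m ℕ.+ 2 ℕ.^ m     ≡⟨ cong (2 ℕ.^ m ℕ.+_) (sym (ℕ.+-identityʳ (2 ℕ.^ m))) ⟩
    2 ℕ.^ suc m             ∎

  ^-comm : ∀ m i j → (m ℕ.^ i) ℕ.^ j ≡ (m ℕ.^ j) ℕ.^ i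
  ^-comm m i j = trans (ℕ.^-*-assoc m i j)
    (trans (cong (m ℕ.^_) (ℕ.*-comm i j)) (sym (ℕ.^-*-assoc m j i)))

  ^-cancel-< : ∀ {a b} k → a ℕ.^ k ℕ.< b ℕ.^ k → a ℕ.< b
  ^-cancel-< k lt = ℕ.≰⇒> λ b≤a → ℕ.<⇒≱ lt (ℕ.^-monoˡ-≤ k b≤a)

  cross : ∀ p d p′ d′ → p ℕ.* suc d′ ℕ.≤ p′ ℕ.* suc d →
          2 ℕ.^ p′ ℕ.< n ℕ.^ suc d′ → 2 ℕ.^ p ℕ.< n ℕ.^ suc d
  cross p d p′ d′ le lt = ^-cancel-< (suc d′) (begin-strict
    (2 ℕ.^ p) ℕ.^ suc d′      ≡⟨ ℕ.^-*-assoc 2 p (suc d′) ⟩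
    2 ℕ.^ (p ℕ.* suc d′)      ≤⟨ ℕ.^-monoʳ-≤ 2 le ⟩
    2 ℕ.^ (p′ ℕ.* suc d)      ≡⟨ sym (ℕ.^-*-assoc 2 p′ (suc d)) ⟩
    (2 ℕ.^ p′) ℕ.^ suc d      <⟨ ℕ.^-monoˡ-< (suc d) lt ⟩
    (n ℕ.^ suc d′) ℕ.^ suc d  ≡⟨ ^-comm n (suc d′) (suc d) ⟩
    (n ℕ.^ suc d) ℕ.^ suc d′  ∎)

  down : ∀ {p q} → p ≤ q → belowLog q → belowLog p
  down {mkℚᵘ -[1+ _ ] _} _ _ = tt
  down {mkℚᵘ (+ p) d} {mkℚᵘ (+ p′) d′} (*≤* le) lt = cross p d p′ d′
    (ℤ.drop‿+≤+ (subst₂ ℤ._≤_ (sym (ℤ.pos-* p (suc d′))) (sym (ℤ.pos-* p′ (suc d))) le)) lt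
  down {mkℚᵘ (+ zero)  _} {mkℚᵘ -[1+ _ ] _} (*≤* ()) _
  down {mkℚᵘ (+ suc _) _} {mkℚᵘ -[1+ _ ] _} (*≤* ()) _

  bernoulli : ∀ a k → (a ℕ.+ k) ℕ.* a ℕ.^ k ℕ.≤ a ℕ.* suc a ℕ.^ k
  bernoulli a zero    = ℕ.≤-reflexive (cong (ℕ._* 1) (ℕ.+-identityʳ a))
  bernoulli a (suc k) = begin
    (a ℕ.+ suc k) ℕ.* (a ℕ.* a ℕ.^ k)
      ≤⟨ ℕ.m≤m+n _ (k ℕ.* a ℕ.^ k) ⟩
    (a ℕ.+ suc k) ℕ.* (a ℕ.* a ℕ.^ k) ℕ.+ k ℕ.* a ℕ.^ k
      ≡⟨ rearrange₁ a k (a ℕ.^ k) ⟩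
    suc a ℕ.* ((a ℕ.+ k) ℕ.* a ℕ.^ k)
      ≤⟨ ℕ.*-monoʳ-≤ (suc a) (bernoulli a k) ⟩
    suc a ℕ.* (a ℕ.* suc a ℕ.^ k)
      ≡⟨ rearrange₂ a (suc a ℕ.^ k) ⟩
    a ℕ.* (suc a ℕ.* suc a ℕ.^ k) ∎
    where
    rearrange₁ : ∀ a k x → (a ℕ.+ suc k) ℕ.* (a ℕ.* x) ℕ.+ k ℕ.* x ≡ suc a ℕ.* ((a ℕ.+ k) ℕ.* x)
    rearrange₁ = solve-∀
    rearrange₂ : ∀ a x → suc a ℕ.* (a ℕ.* x) ≡ a ℕ.* (suc a ℕ.* x)
    rearrange₂ = solve-∀

  doubling : ∀ a → .{{ℕ.NonZero a}} → 2 ℕ.* a ℕ.^ suc a ℕ.< suc a ℕ.^ suc a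
  doubling a = ℕ.*-cancelˡ-< a _ _ (begin-strict
    a ℕ.* (2 ℕ.* a ℕ.^ suc a)       ≡⟨ rearrange a (a ℕ.^ suc a) ⟩
    (a ℕ.+ a) ℕ.* a ℕ.^ suc a       <⟨ ℕ.*-monoˡ-< (a ℕ.^ suc a) {{ℕ.m^n≢0 a (suc a)}}
                                         (ℕ.+-monoʳ-< a (ℕ.n<1+n a)) ⟩
    (a ℕ.+ suc a) ℕ.* a ℕ.^ suc a   ≤⟨ bernoulli a (suc a) ⟩
    a ℕ.* suc a ℕ.^ suc a           ∎)
    where
    rearrange : ∀ a x → a ℕ.* (2 ℕ.* x) ≡ (a ℕ.+ a) ℕ.* x
    rearrange = solve-∀

  up : ∀ {p} → belowLog p → ∃ λ q → p < q × belowLog q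
  up {mkℚᵘ -[1+ m ] d} _ =
    mkℚᵘ -[1+ m ] (suc d) ,
    *<* (ℤ.*-monoˡ-<-neg -[1+ m ] (+<+ (ℕ.n<1+n (suc d)))) ,
    tt
  up {mkℚᵘ (+ p) d} lt = q , *<* ineq , power
    where
    a = 2 ℕ.^ p
    d′ = d ℕ.+ a ℕ.* suc d
    p′ = suc (p ℕ.* suc a)
    q = mkℚᵘ (+ p′) d′
    rearrange : ∀ p a d → p ℕ.* (suc a ℕ.* suc d) ≡ p ℕ.* suc a ℕ.* suc d
    rearrange = solve-∀
    ineq : + p ℤ.* + suc d′ ℤ.< + p′ ℤ.* + suc d
    ineq = subst₂ ℤ._<_ (ℤ.pos-* p (suc d′)) (ℤ.pos-* p′ (suc d)) (+<+ (begin-strict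
      p ℕ.* suc d′                ≡⟨ rearrange p a d ⟩
      p ℕ.* suc a ℕ.* suc d       <⟨ ℕ.*-monoˡ-< (suc d) (ℕ.n<1+n (p ℕ.* suc a)) ⟩
      p′ ℕ.* suc d                ∎))
    power : 2 ℕ.^ p′ ℕ.< n ℕ.^ suc d′
    power = begin-strict
      2 ℕ.* 2 ℕ.^ (p ℕ.* suc a)   ≡⟨ cong (2 ℕ.*_) (sym (ℕ.^-*-assoc 2 p (suc a))) ⟩
      2 ℕ.* a ℕ.^ suc a           <⟨ doubling a {{ℕ.m^n≢0 2 p}} ⟩
      suc a ℕ.^ suc a             ≤⟨ ℕ.^-monoˡ-≤ (suc a) lt ⟩
      (n ℕ.^ suc d) ℕ.^ suc a     ≡⟨ ^-comm n (suc d) (suc a) ⟩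
      (n ℕ.^ suc a) ℕ.^ suc d     ≡⟨ ℕ.^-*-assoc n (suc a) (suc d) ⟩
      n ℕ.^ suc d′                ∎

-- The base of the logarithm is 2; quotients of logarithms do not depend
-- on it.  By convention log 0 = 0.
log : ℕ → ℝ
log n = record
  { below     = belowLog
  ; inhabited = mkℚᵘ -[1+ 0 ] 0 , tt
  ; bounded   = mkℚᵘ (+ n) 0 ,
                λ lt → ℕ.<-asym (n<2^n n) (subst (2 ℕ.^ n ℕ.<_) (ℕ.*-identityʳ n) lt)
  ; closed    = down
  ; rounded   = up
  }
  where open Logarithm n

instance
  log-positive : ∀ {n} → .{{NonTrivial n}} → Positive (log n)
  log-positive {n} = positive
    (subst (1 ℕ.<_) (sym (ℕ.*-identityʳ n)) (ℕ.nonTrivial⇒n>1 n))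

module Quotient (x y : ℝ) {{y>0 : Positive y}} where

  -- For y > 0, q < x / y iff q · y < x, i.e. iff y lies between positive
  -- rationals lo and hi such that q · lo and q · hi are both at most
  -- some rational s < x.
  record BelowQuotient (q : ℚᵘ) : Set where
    field
      {s lo hi} : ℚᵘ
      s<x       : below x s
      0<lo      : 0ℚᵘ < lo
      lo<y      : below y lo
      hi≮y      : ¬ below y hi
      q·lo≤s    : q * lo ≤ s
      q·hi≤s    : q * hi ≤ s

    lo<hi : lo < hi
    lo<hi = ℚ.≰⇒> λ hi≤lo → hi≮y (ℝ.closed y hi≤lo lo<y)

    0<hi : 0ℚᵘ < hi
    0<hi = ℚ.<-trans 0<lo lo<hi

  private
    y₀ : ℚᵘ
    y₀ = proj₁ (ℝ.rounded y (Positive.0<x y>0))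

    0<y₀ : 0ℚᵘ < y₀
    0<y₀ = proj₁ (proj₂ (ℝ.rounded y (Positive.0<x y>0)))

    y₀<y : below y y₀
    y₀<y = proj₂ (proj₂ (ℝ.rounded y (Positive.0<x y>0)))

    instance
      y₀-pos : ℚ.Positive y₀
      y₀-pos = ℚ.positive 0<y₀

      y₀-nonZero : ℚ.NonZero y₀
      y₀-nonZero = ℚ.>-nonZero 0<y₀

    p/y₀·y₀≃p : ∀ p → p * 1/ y₀ * y₀ ℚ.≃ p
    p/y₀·y₀≃p p = ℚ.≃-trans (ℚ.*-assoc p (1/ y₀) y₀)
      (ℚ.≃-trans (ℚ.*-congˡ {p} (ℚ.*-inverseˡ y₀)) (ℚ.*-identityʳ p))

  inhabited : ∃ λ q → BelowQuotient q
  inhabited = s * 1/ y₀ , record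
    { s<x    = ℝ.closed x (ℚ.p⊓q≤p _ 0ℚᵘ) (proj₂ (ℝ.inhabited x))
    ; 0<lo   = 0<y₀
    ; lo<y   = y₀<y
    ; hi≮y   = proj₂ (ℝ.bounded y)
    ; q·lo≤s = ℚ.≤-reflexive (p/y₀·y₀≃p s)
    ; q·hi≤s = ℚ.≤-trans
        (ℚ.*-monoʳ-≤-nonPos (s * 1/ y₀) {{ℚ.nonPositive q≤0}} y₀≤hi)
        (ℚ.≤-reflexive (p/y₀·y₀≃p s))
    }
    where
    s = proj₁ (ℝ.inhabited x) ℚ.⊓ 0ℚᵘ
    q≤0 : s * 1/ y₀ ≤ 0ℚᵘ
    q≤0 = ℚ.*-cancelʳ-≤-pos y₀ (ℚ.≤-respˡ-≃ (ℚ.≃-sym (p/y₀·y₀≃p s))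
      (ℚ.≤-respʳ-≃ (ℚ.≃-sym (ℚ.*-zeroˡ y₀)) (ℚ.p⊓q≤q (proj₁ (ℝ.inhabited x)) 0ℚᵘ)))
    y₀≤hi : y₀ ≤ proj₁ (ℝ.bounded y)
    y₀≤hi = ℚ.≮⇒≥ λ hi<y₀ → proj₂ (ℝ.bounded y) (ℝ.closed y (ℚ.<⇒≤ hi<y₀) y₀<y)

  bounded : ∃ λ q → ¬ BelowQuotient q
  bounded = m * 1/ y₀ , λ b → let open BelowQuotient b in
    proj₂ (ℝ.bounded x) (ℝ.closed x
      (ℚ.≤-trans (ℚ.p≤p⊔q (proj₁ (ℝ.bounded x)) 0ℚᵘ)
      (ℚ.≤-trans (ℚ.≤-reflexive (ℚ.≃-sym (p/y₀·y₀≃p m)))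
      (ℚ.≤-trans (ℚ.*-monoʳ-≤-nonNeg (m * 1/ y₀) {{ℚ.nonNegative 0≤q}} (y₀≤ hi≮y))
        q·hi≤s))) s<x)
    where
    m = proj₁ (ℝ.bounded x) ℚ.⊔ 0ℚᵘ
    0≤q : 0ℚᵘ ≤ m * 1/ y₀
    0≤q = ℚ.*-cancelʳ-≤-pos y₀ (ℚ.≤-respʳ-≃ (ℚ.≃-sym (p/y₀·y₀≃p m))
      (ℚ.≤-respˡ-≃ (ℚ.≃-sym (ℚ.*-zeroˡ y₀)) (ℚ.p≤q⊔p (proj₁ (ℝ.bounded x)) 0ℚᵘ)))
    y₀≤ : ∀ {t} → ¬ below y t → y₀ ≤ t
    y₀≤ t≮y = ℚ.≮⇒≥ λ t<y₀ → t≮y (ℝ.closed y (ℚ.<⇒≤ t<y₀) y₀<y)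

  closed : ∀ {p q} → p ≤ q → BelowQuotient q → BelowQuotient p
  closed p≤q b = record
    { s<x    = s<x
    ; 0<lo   = 0<lo
    ; lo<y   = lo<y
    ; hi≮y   = hi≮y
    ; q·lo≤s = ℚ.≤-trans (ℚ.*-monoˡ-≤-nonNeg lo {{ℚ.nonNegative (ℚ.<⇒≤ 0<lo)}} p≤q) q·lo≤s
    ; q·hi≤s = ℚ.≤-trans (ℚ.*-monoˡ-≤-nonNeg hi {{ℚ.nonNegative (ℚ.<⇒≤ 0<hi)}} p≤q) q·hi≤s
    }
    where open BelowQuotient b

  rounded : ∀ {p} → BelowQuotient p → ∃ λ q → p < q × BelowQuotient q
  rounded {p} b = p + δ , p<p+δ , record
    { s<x    = s′<x
    ; 0<lo   = 0<lo
    ; lo<y   = lo<y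
    ; hi≮y   = hi≮y
    ; q·lo≤s = add q·lo≤s (ℚ.≤-trans
        (ℚ.*-monoʳ-≤-nonNeg δ {{ℚ.nonNegative (ℚ.<⇒≤ 0<δ)}} (ℚ.<⇒≤ lo<hi))
        (ℚ.≤-reflexive δ·hi≃))
    ; q·hi≤s = add q·hi≤s (ℚ.≤-reflexive δ·hi≃)
    }
    where
    open BelowQuotient b
    s′ = proj₁ (ℝ.rounded x s<x)
    s<s′ : s < s′
    s<s′ = proj₁ (proj₂ (ℝ.rounded x s<x))
    s′<x : below x s′
    s′<x = proj₂ (proj₂ (ℝ.rounded x s<x))
    instance
      hi-nonZero : ℚ.NonZero hi
      hi-nonZero = ℚ.>-nonZero 0<hi
    δ : ℚᵘ
    δ = (s′ - s) * 1/ hi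
    δ·hi≃ : δ * hi ℚ.≃ s′ - s
    δ·hi≃ = ℚ.≃-trans (ℚ.*-assoc (s′ - s) (1/ hi) hi)
      (ℚ.≃-trans (ℚ.*-congˡ {s′ - s} (ℚ.*-inverseˡ hi)) (ℚ.*-identityʳ (s′ - s)))
    0<s′-s : 0ℚᵘ < s′ - s
    0<s′-s = ℚ.<-respˡ-≃ (ℚ.+-inverseʳ s) (ℚ.+-monoˡ-< (ℚ.- s) s<s′)
    0<δ : 0ℚᵘ < δ
    0<δ = ℚ.*-cancelʳ-<-nonNeg hi {{ℚ.nonNegative (ℚ.<⇒≤ 0<hi)}}
      (ℚ.<-respʳ-≃ (ℚ.≃-sym δ·hi≃) (ℚ.<-respˡ-≃ (ℚ.≃-sym (ℚ.*-zeroˡ hi)) 0<s′-s))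
    p<p+δ : p < p + δ
    p<p+δ = ℚ.<-respˡ-≃ (ℚ.+-identityʳ p) (ℚ.+-monoʳ-< p 0<δ)
    s+[s′-s]≃s′ : s + (s′ - s) ℚ.≃ s′
    s+[s′-s]≃s′ = ℚ.≃-trans (ℚ.+-congʳ s (ℚ.+-comm s′ (ℚ.- s)))
      (ℚ.≃-trans (ℚ.≃-sym (ℚ.+-assoc s (ℚ.- s) s′))
      (ℚ.≃-trans (ℚ.+-congˡ s′ (ℚ.+-inverseʳ s)) (ℚ.+-identityˡ s′)))
    add : ∀ {t} → p * t ≤ s → δ * t ≤ s′ - s → (p + δ) * t ≤ s′
    add {t} pt δt = ℚ.≤-trans (ℚ.≤-reflexive (ℚ.*-distribʳ-+ t p δ))
      (ℚ.≤-trans (ℚ.+-mono-≤ pt δt) (ℚ.≤-reflexive s+[s′-s]≃s′))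

infixl 7 _/_

_/_ : (x y : ℝ) → {{Positive y}} → ℝ
x / y = record
  { below     = BelowQuotient
  ; inhabited = inhabited
  ; bounded   = bounded
  ; closed    = closed
  ; rounded   = rounded
  }
  where open Quotient x y

-- liminf aₖ = supₙ inf { aₖ ∣ k ≥ n } and limsup aₖ = infₙ sup { aₖ ∣ k ≥ n },
-- for sequences whose tails are bounded.

Tail : (ℕ → ℝ) → ℕ → Pred ℝ (lsuc 0ℓ)
Tail a n x = ∃ λ k → n ℕ.≤ k × x ≡ a k

IsLimInf : (ℕ → ℝ) → ℝ → Set₁
IsLimInf a ℓ = ∃ λ (i : ℕ → ℝ) →
  (∀ n → IsInf _≤ᵣ_ (Tail a n) (i n)) × IsSup _≤ᵣ_ (Image i U) ℓ

IsLimSup : (ℕ → ℝ) → ℝ → Set₁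
IsLimSup a ℓ = ∃ λ (s : ℕ → ℝ) →
  (∀ n → IsSup _≤ᵣ_ (Tail a n) (s n)) × IsInf _≤ᵣ_ (Image s U) ℓ

record Graph : Set₁ where
  infix 4 _~_
  field
    V             : Set
    _~_           : Rel V 0ℓ
    ~-sym         : ∀ {x y} → x ~ y → y ~ x
    ~-irrefl      : ∀ {x} → ¬ x ~ x
    connected     : ∀ x y → Star _~_ x y
    locallyFinite : ∀ x → Finite (setoid V) (x ~_)
    infinite      : ¬ Finite (setoid V) {0ℓ} U

  deg : V → ℕ
  deg x = length (proj₁ (locallyFinite x))

-- A graph whose vertices form a subset of V; only the restriction of
-- Adj to that subset matters.
record GraphWithin (V : Set) (ℓ : Level) : Set (lsuc ℓ) where
  field
    Vertex : Pred V 0ℓ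
    Adj    : Rel V ℓ

-- The values of f outside the vertex set of G are irrelevant.
record IsIsomorphism {V W : Set} {ℓ₁ ℓ₂ : Level} (G : GraphWithin V ℓ₁)
                     (H : GraphWithin W ℓ₂) (f : V → W) : Set (ℓ₁ ⊔ ℓ₂) where
  private
    module G = GraphWithin G
    module H = GraphWithin H
  field
    maps       : ∀ {x} → G.Vertex x → H.Vertex (f x)
    injective  : ∀ {x y} → G.Vertex x → G.Vertex y → f x ≡ f y → x ≡ y
    surjective : ∀ {z} → H.Vertex z → ∃ λ x → G.Vertex x × z ≡ f x
    adjacency  : ∀ {x y} → G.Vertex x → G.Vertex y → G.Adj x y ⇔ H.Adj (f x) (f y)

steps : {A : Set} {R : Rel A 0ℓ} {x y : A} → Star R x y → ℕ
steps ε       = 0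
steps (_ ◅ w) = suc (steps w)

module _ (X : Graph) where
  open Graph X

  IsDistance : V → V → ℕ → Set
  IsDistance x y n = (∃ λ (w : Star _~_ x y) → steps w ≡ n) × (∀ (w : Star _~_ x y) → n ℕ.≤ steps w)

  boundary : Pred V 0ℓ → Pred V 0ℓ
  boundary C x = ¬ C x × ∃ λ y → C y × y ~ x

  closure : Pred V 0ℓ → Pred V 0ℓ
  closure C = C ∪ boundary C

  whole : GraphWithin V 0ℓ
  whole = record { Vertex = U ; Adj = _~_ }

  closureGraph : Pred V 0ℓ → GraphWithin V 0ℓ
  closureGraph C = record { Vertex = closure C ; Adj = _~_ }

  Step : Pred V 0ℓ → Rel V 0ℓ
  Step S x y = S x × S y × x ~ y

  IsComponent : Pred V 0ℓ → Pred V 0ℓ → Set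
  IsComponent S C = ∃ λ x → S x × C ≐ Star (Step S) x

  module _ (F : Pred V 0ℓ) where

    IsCell : Pred V 0ℓ → Set
    IsCell = IsComponent (∁ F)

    reduced : GraphWithin V (lsuc 0ℓ)
    reduced = record
      { Vertex = F
      ; Adj    = λ x y → x ≢ y × ∃ λ C → IsCell C × boundary C x × boundary C y
      }

    record IsSelfSimilar (ψ : V → V) : Set₁ where
      field
        F1 : ∀ {x y} → F x → F y → ¬ x ~ y
        F2 : ∀ {C D} → IsCell C → IsCell D → ¬ C ≐ D →
             ∀ {x y} → closure C x → closure D x → closure C y → closure D y → x ≡ y
        F3 : IsIsomorphism whole reduced ψ

    record IsHomogeneouslySelfSimilar (ψ : V → V) : Set₁ where
      field
        isSelfSimilar : IsSelfSimilar ψ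
        H1-finite     : ∀ {C} → IsCell C → Finite (setoid V) (closure C)
        H1-isomorphic : ∀ {C D} → IsCell C → IsCell D →
                        ∃ λ α → IsIsomorphism (closureGraph C) (closureGraph D) α ×
                                Image α (boundary C) ≐ boundary D
        H2            : ∀ {C} → IsCell C → ∀ {v₁ v₂ v₃ v₄} →
                        boundary C v₁ → boundary C v₂ → boundary C v₃ → boundary C v₄ →
                        v₁ ≢ v₂ → v₃ ≢ v₄ →
                        ∀ {m n} → IsDistance v₁ v₂ m → IsDistance v₃ v₄ n → m ≡ n

      open IsSelfSimilar isSelfSimilar public

    -- The length and volume scaling factors are read off from an arbitrary
    -- cell (with two boundary vertices) and an arbitrary 2-cell; that they
    -- do not depend on these choices is not assumed.

    IsLengthScalingFactor : ℕ → Set₁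
    IsLengthScalingFactor ν = ∃ λ C → IsCell C × ∃₂ λ v w →
      boundary C v × boundary C w × v ≢ w × IsDistance v w ν

    lengthScalingFactor-nonTrivial :
      ∀ {ψ ν} → IsHomogeneouslySelfSimilar ψ → IsLengthScalingFactor ν → NonTrivial ν
    lengthScalingFactor-nonTrivial hss
      (C , (c , c∉F , C⊆ , ⊆C) , v , w , v∈θC , w∈θC , v≢w , (p , refl) , _) = go p
      where
      open IsHomogeneouslySelfSimilar hss

      end∉F : ∀ {x y} → ¬ F x → Star (Step (∁ F)) x y → ¬ F y
      end∉F x∉F ε                     = x∉F
      end∉F _   ((_ , y∉F , _) ◅ path) = end∉F y∉F path

      boundary⊆F : ∀ {x} → boundary C x → ¬ ¬ F x
      boundary⊆F (x∉C , y , y∈C , y~x) x∉F =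
        x∉C (⊆C (C⊆ y∈C ◅◅ ((end∉F c∉F (C⊆ y∈C) , x∉F , y~x) ◅ ε)))

      go : (p : Star _~_ v w) → NonTrivial (steps p)
      go ε             = contradiction refl v≢w
      go (v~w ◅ ε)     =
        contradiction (λ v∈F → boundary⊆F w∈θC λ w∈F → F1 v∈F w∈F v~w) (boundary⊆F v∈θC)
      go (_ ◅ (_ ◅ _)) = _

  iteratedImage : (V → V) → ℕ → Pred V 0ℓ
  iteratedImage ψ zero    = U
  iteratedImage ψ (suc n) = Image ψ (iteratedImage ψ n)

  -- D is a 2-cell, that is, a component of the complement of ψ²(V).
  IsVolumeScalingFactor : Pred V 0ℓ → (V → V) → ℕ → Set₁
  IsVolumeScalingFactor F ψ μ = ∃ λ D → IsCell (iteratedImage ψ 2) D ×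
    HasCardinality (≐-setoid V 0ℓ) (λ C → IsCell F C × C ⊆ D) μ

  BoundedGeometry : Set
  BoundedGeometry = ∃ λ b → ∀ x → deg x ℕ.≤ b

  Ball : V → ℕ → Pred V 0ℓ
  Ball x r y = ∃ λ n → IsDistance y x n × n ℕ.≤ r

  HasVolume : Pred V 0ℓ → ℕ → Set
  HasVolume A v = ∃ λ ys → Enumerates (setoid V) ys A × v ≡ sum (map deg ys)

  BallVolume : ℕ → Pred ℕ 0ℓ
  BallVolume r v = ∃ λ x → HasVolume (Ball x r) v

  -- log f(r) / log r, at r = k + 2 since the quotient needs r ≥ 2.
  growthExponent : (ℕ → ℕ) → ℕ → ℝ
  growthExponent f k = log (f (2 ℕ.+ k)) / log (2 ℕ.+ k)

  IsLowerGlobalGrowthDimension : ℝ → Set₁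
  IsLowerGlobalGrowthDimension d = ∃ λ (V̲ : ℕ → ℕ) →
    (∀ r → IsInf ℕ._≤_ (BallVolume r) (V̲ r)) × IsLimInf (growthExponent V̲) d

  IsUpperGlobalGrowthDimension : ℝ → Set₁
  IsUpperGlobalGrowthDimension d = ∃ λ (V̅ : ℕ → ℕ) →
    (∀ r → IsSup ℕ._≤_ (BallVolume r) (V̅ r)) × IsLimSup (growthExponent V̅) d

{-# OPTIONS --safe #-}

-- Represent a cell by any of its vertices, and call a cell c a child of a
-- cell a if ψ maps a vertex of a into the boundary of c.  Every cell has
-- exactly one parent, since the preimage under ψ of its boundary is a
-- clique which, by F1, meets exactly one cell.  It has exactly μ children:
-- ψ turns the ordered edges of the closure of a cell into the ordered
-- pairs of different boundary vertices of its children, and by H1 both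
-- numbers of pairs are the same for all cells, while for one particular
-- cell the children are the cells inside a 2-cell.
--
-- By H2, ψ multiplies distances exactly by ν.  With δ the diameter of the
-- cell closures, a cell is therefore within distance 3δνⁿ of the image
-- under ψⁿ of its n-th ancestor.  Hence a ball of radius (6δ + 1)νⁿ contains
-- the μⁿ descendants of an n-th ancestor, and a ball of radius νⁿ is covered
-- by the descendants of boundedly many cells, so that its volume is at most
-- a constant times μⁿ.  Taking logarithms gives the dimensions.

module Submission where

open import Axiom.ExcludedMiddle using (ExcludedMiddle)
open import Data.Integer.Base as ℤ using (+_; -[1+_]; +<+; -<+)
import Data.Integer.Properties as ℤ
open import Data.List.Base using (List; []; _∷_; [_]; _++_; length; map; concatMap; cartesianProduct; filter; deduplicate)
open import Data.List.Membership.Propositional using (_∈_; find; lose)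
open import Data.List.Membership.Propositional.Properties
  using (∈-∃++; ∈-++⁻; ∈-++⁺ˡ; ∈-++⁺ʳ; ∈-concatMap⁺; ∈-concatMap⁻; ∈-cartesianProduct⁺; ∈-cartesianProduct⁻)
import Data.List.Membership.Setoid as Membership
import Data.List.Membership.Setoid.Properties as Membershipₚ
import Data.List.Properties as List
import Data.List.Relation.Unary.All as All
import Data.List.Relation.Unary.AllPairs as AllPairs
open import Data.List.Relation.Unary.AllPairs.Core using (AllPairs; []; _∷_)
import Data.List.Relation.Unary.Any as Any
open import Data.List.Relation.Unary.Any using (here; there)
open import Data.List.Relation.Unary.Unique.DecSetoid.Properties using (deduplicate-!)
import Data.List.Relation.Unary.Unique.Propositional.Properties as Unique-≡
import Data.List.Relation.Unary.Unique.Setoid as Uniqueness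
import Data.List.Relation.Unary.Unique.Setoid.Properties as Uniqueₚ
open import Data.Nat.Base
  using (ℕ; zero; suc; _+_; _*_; _^_; _≤_; _<_; _⊔_; z≤n; s≤s; NonZero; NonTrivial; nonTrivial⇒nonZero; nonTrivial⇒n>1; >-nonZero⁻¹)
open import Data.Nat.ListAction using (sum)
import Data.Nat.Properties as ℕ
open import Data.Nat.Tactic.RingSolver using (solve-∀)
open import Data.Product using (∃; ∃₂; _×_; _,_; proj₁; proj₂)
import Data.Rational.Unnormalised as ℚ
open import Data.Rational.Unnormalised using (ℚᵘ; mkℚᵘ; 0ℚᵘ; *≤*; *<*)
import Data.Rational.Unnormalised.Properties as ℚ
open import Data.Sum.Base using (_⊎_; inj₁; inj₂; [_,_]′)
open import Data.Unit.Base using (tt)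
open import Function.Base using (flip; id; _∘_)
open import Function.Bundles using (mk⇔; module Equivalence)
open import Level using (Level; 0ℓ; Lift; lift; lower) renaming (suc to lsuc)
open import Relation.Binary.Bundles using (Setoid; DecSetoid)
open import Relation.Binary.Construct.Closure.ReflexiveTransitive using (Star; ε; _◅_; _◅◅_; reverse)
open import Relation.Binary.Core using (Rel; REL)
open import Relation.Binary.PropositionalEquality
  using (_≡_; _≢_; refl; sym; trans; cong; cong₂; subst; subst₂; setoid)
open import Relation.Nullary using (¬_; Dec; yes; no; contradiction)
open import Relation.Nullary.Decidable using (map′; decidable-stable; recompute)
open import Relation.Unary using (Pred; U; ∁; _≐_; _⊆_)
open import Relation.Unary.Relation.Binary.Equality using (≐-setoid)
open import Defs

open Equivalence using (to; from)
open ℕ.≤-Reasoning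

private variable
  a b ℓ r : Level
  A B : Set a

-- Counting with finite lists

∈-delete : ∀ {x y : A} xs {zs} → x ≢ y → x ∈ xs ++ y ∷ zs → x ∈ xs ++ zs
∈-delete xs x≢y x∈ with ∈-++⁻ xs x∈
... | inj₁ x∈xs         = ∈-++⁺ˡ x∈xs
... | inj₂ (here x≡y)   = contradiction x≡y x≢y
... | inj₂ (there x∈zs) = ∈-++⁺ʳ xs x∈zs

∈⇒length≢0 : ∀ {x : A} {xs} → x ∈ xs → NonZero (length xs)
∈⇒length≢0 {xs = _ ∷ _} _ = _

-- Pigeonhole principle: the partner of the head is deleted from `ys`, and injectivity keeps the
-- partners of all other entries in the list. Injectivity is only asked up to `_≈_`, so that
-- representatives of classes can be counted.
length-mono : {A : Set a} {B : Set b} {_≈_ : Rel A ℓ} (R : REL A B r) →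
  (∀ {x x′ y} → R x y → R x′ y → x ≈ x′) →
  ∀ {xs} ys → AllPairs (λ x y → ¬ x ≈ y) xs →
  (∀ {x} → x ∈ xs → ∃ λ y → y ∈ ys × R x y) → length xs ≤ length ys
length-mono R inj ys []            R-total = z≤n
length-mono {_≈_ = _≈_} R inj ys (_∷_ {x} {xs} x≉ xs!) R-total
  with y , y∈ys , Rxy ← R-total (here refl)
  with ys₁ , ys₂ , refl ← ∈-∃++ y∈ys = begin
    suc (length xs)            ≤⟨ s≤s (length-mono {_≈_ = _≈_} R inj (ys₁ ++ ys₂) xs! R-total′) ⟩
    suc (length (ys₁ ++ ys₂))  ≡⟨ List.length-++-sucʳ ys₁ y ys₂ ⟨
    length (ys₁ ++ y ∷ ys₂)    ∎
  where
  R-total′ : ∀ {x′} → x′ ∈ xs → ∃ λ y′ → y′ ∈ ys₁ ++ ys₂ × R x′ y′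
  R-total′ x′∈xs with y′ , y′∈ys , Rx′y′ ← R-total (there x′∈xs) =
    y′ , ∈-delete ys₁ (λ { refl → All.lookup x≉ x′∈xs (inj Rxy Rx′y′) }) y′∈ys , Rx′y′

length-⊆ : ∀ {xs ys : List A} → AllPairs _≢_ xs → (∀ {x} → x ∈ xs → x ∈ ys) →
           length xs ≤ length ys
length-⊆ {ys = ys} xs! xs⊆ys =
  length-mono {_≈_ = _≡_} _≡_ (λ p q → trans p (sym q)) ys xs! λ x∈xs → _ , xs⊆ys x∈xs , refl

length-cartesianProduct : (xs : List A) (ys : List B) →
  length (cartesianProduct xs ys) ≡ length xs * length ys
length-cartesianProduct []       ys = refl
length-cartesianProduct (x ∷ xs) ys = trans (List.length-++ (map (x ,_) ys))
  (trans (cong (_+ _) (List.length-map (x ,_) ys)) (cong (λ k → length ys + k) (length-cartesianProduct xs ys)))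

length-concatMap-≤ : ∀ {k} (f : A → List B) → (∀ x → length (f x) ≤ k) →
  ∀ xs → length (concatMap f xs) ≤ length xs * k
length-concatMap-≤ f f≤k []       = z≤n
length-concatMap-≤ f f≤k (x ∷ xs) = ℕ.≤-trans
  (ℕ.≤-reflexive (List.length-++ (f x))) (ℕ.+-mono-≤ (f≤k x) (length-concatMap-≤ f f≤k xs))

length-concatMap-≥ : ∀ {k} (f : A → List B) xs → (∀ {x} → x ∈ xs → k ≤ length (f x)) →
  length xs * k ≤ length (concatMap f xs)
length-concatMap-≥ f []       f≥k = z≤n
length-concatMap-≥ f (x ∷ xs) f≥k = ℕ.≤-trans
  (ℕ.+-mono-≤ (f≥k (here refl)) (length-concatMap-≥ f xs (f≥k ∘ there)))
  (ℕ.≤-reflexive (sym (List.length-++ (f x))))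

∈-concatMap : ∀ (f : A → List B) {x y xs} → x ∈ xs → y ∈ f x → y ∈ concatMap f xs
∈-concatMap f x∈xs y∈fx = ∈-concatMap⁺ f (lose x∈xs y∈fx)

∈-concatMap-∃ : ∀ (f : A → List B) {y xs} → y ∈ concatMap f xs → ∃ λ x → x ∈ xs × y ∈ f x
∈-concatMap-∃ f y∈ = find (∈-concatMap⁻ f y∈)

module _ {c ℓ} (S : Setoid c ℓ) where
  open Setoid S using (Carrier; _≈_) renaming (sym to ≈-sym; trans to ≈-trans)
  open Uniqueness S using (Unique)

  concatMap-! : {A : Set a} {_~_ : Rel A r} {f : A → List Carrier} → (∀ x → Unique (f x)) →
    (∀ {x y u v} → u ∈ f x → v ∈ f y → u ≈ v → x ~ y) →
    ∀ {xs} → AllPairs (λ x y → ¬ x ~ y) xs → Unique (concatMap f xs)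
  concatMap-! f! f-disjoint []         = []
  concatMap-! {f = f} f! f-disjoint (_∷_ {x} {xs} x≁ xs!) =
    Uniqueₚ.++⁺ S (f! x) (concatMap-! f! f-disjoint xs!) λ (v∈fx , v∈rest) →
      let u , u∈fx , v≈u = find v∈fx
          w , w∈rest , v≈w = find v∈rest
          y , y∈xs , w∈fy = ∈-concatMap-∃ f {xs = xs} w∈rest
      in All.lookup x≁ y∈xs (f-disjoint u∈fx w∈fy (≈-trans (≈-sym v≈u) v≈w))

  -- A list of pairwise inequivalent entries supplies canonical representatives, which turns
  -- equivalence of cells into equality.
  Unique-≈⇒≡ : ∀ {xs x y} → Unique xs → x ∈ xs → y ∈ xs → x ≈ y → x ≡ y
  Unique-≈⇒≡ (_  ∷ _)   (here refl) (here refl) _   = refl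
  Unique-≈⇒≡ (x≉ ∷ _)   (here refl) (there y∈)  x≈y = contradiction x≈y (All.lookup x≉ y∈)
  Unique-≈⇒≡ (y≉ ∷ _)   (there x∈)  (here refl) x≈y = contradiction (≈-sym x≈y) (All.lookup y≉ x∈)
  Unique-≈⇒≡ (_  ∷ xs!) (there x∈)  (there y∈)  x≈y = Unique-≈⇒≡ xs! x∈ y∈ x≈y

bound : {P : A → Pred ℕ ℓ} → (∀ {x m n} → m ≤ n → P x m → P x n) →
  ∀ xs → (∀ {x} → x ∈ xs → ∃ (P x)) → ∃ λ n → ∀ {x} → x ∈ xs → P x n
bound mono []       bounded = 0 , λ ()
bound mono (x ∷ xs) bounded =
  let m , Pxm = bounded (here refl)
      n , P   = bound mono xs (bounded ∘ there)
  in m ⊔ n , λ { (here refl) → mono (ℕ.m≤m⊔n m n) Pxm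
               ; (there x∈) → mono (ℕ.m≤n⊔m m n) (P x∈) }

sum-map-≤ : ∀ {k} (f : A → ℕ) → (∀ x → f x ≤ k) → ∀ xs → sum (map f xs) ≤ length xs * k
sum-map-≤ f f≤k []       = z≤n
sum-map-≤ f f≤k (x ∷ xs) = ℕ.+-mono-≤ (f≤k x) (sum-map-≤ f f≤k xs)

sum-map-≥ : (f : A → ℕ) → (∀ x → 1 ≤ f x) → ∀ xs → length xs ≤ sum (map f xs)
sum-map-≥ f f≥1 []       = z≤n
sum-map-≥ f f≥1 (x ∷ xs) = ℕ.+-mono-≤ (f≥1 x) (sum-map-≥ f f≥1 xs)

-- Consequences of excluded middle

module Classical (em : ExcludedMiddle (lsuc 0ℓ)) where

  decide : (P : Set) → Dec P
  decide P = map′ lower lift (em {Lift (lsuc 0ℓ) P})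

  ¬¬-elim : {P : Set} → ¬ ¬ P → P
  ¬¬-elim {P} = decidable-stable (decide P)

  least : (P : Pred ℕ 0ℓ) → ∃ P → ∃ λ m → P m × (∀ {n} → P n → m ≤ n)
  least P (n , Pn) = search n 0 (λ _ → z≤n) (subst P (sym (ℕ.+-identityʳ n)) Pn)
    where
    -- `k` is fuel: `m` stays a lower bound of `P`, and the known element `k + m` stays fixed.
    search : ∀ k m → (∀ {i} → P i → m ≤ i) → P (k + m) → ∃ λ m → P m × (∀ {n} → P n → m ≤ n)
    search zero    m m≤ Pm = m , Pm , m≤
    search (suc k) m m≤ P+ with decide (P m)
    ... | yes Pm = m , Pm , m≤
    ... | no ¬Pm = search k (suc m)
      (λ {i} Pi → ℕ.≤∧≢⇒< (m≤ Pi) λ { refl → ¬Pm Pi }) (subst P (sym (ℕ.+-suc k m)) P+)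

  infimum : (P : Pred ℕ 0ℓ) → ∃ P → ∃ λ m → P m × IsInf _≤_ P m
  infimum P ∃P = let m , Pm , m≤ = least P ∃P in m , Pm , m≤ , λ b b≤ → b≤ Pm

  -- The least upper bound is attained: if `P` missed it, its predecessor would be an upper bound
  -- too. At 0 there is no predecessor, but then the given element is 0 itself.
  supremum : (P : Pred ℕ 0ℓ) → ∃ P → ∀ {k} → (∀ {n} → P n → n ≤ k) → ∃ λ m → P m × IsSup _≤_ P m
  supremum P (n , Pn) {k} ≤k with m , ≤m , min ← least (λ m → ∀ {n} → P n → n ≤ m) (k , ≤k) with decide (P m)
  ... | yes Pm = m , Pm , ≤m , λ b ≤b → ≤b Pm
  ... | no ¬Pm = contradiction Pn λ Pn → attained m ≤m min ¬Pm
    where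
    attained : ∀ m → (∀ {n} → P n → n ≤ m) → (∀ {j} → (∀ {n} → P n → n ≤ j) → m ≤ j) → ¬ ¬ P m
    attained zero    ≤m min ¬Pm = ¬Pm (subst P (ℕ.n≤0⇒n≡0 (≤m Pn)) Pn)
    attained (suc m) ≤m min ¬Pm = ℕ.<-irrefl refl
      (min λ Pj → ℕ.≤-pred (ℕ.≤∧≢⇒< (≤m Pj) λ { refl → ¬Pm Pj }))

  module _ (S : Setoid 0ℓ 0ℓ) where
    open Setoid S using (Carrier; _≈_; isEquivalence) renaming (sym to ≈-sym; trans to ≈-trans)
    open Membership S using () renaming (_∈_ to _∈ₛ_)

    enumerate : (P : Pred Carrier 0ℓ) → (∀ {x y} → x ≈ y → P x → P y) →
      ∀ xs → (∀ {x} → P x → x ∈ₛ xs) → Finite S P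
    enumerate P resp xs cover = deduplicate _≟_ (filter P? xs) ,
      deduplicate-! decS (filter P? xs) , λ x → mk⇔
        (λ Px → Membershipₚ.∈-deduplicate⁺ S _≟_ (λ p q → ≈-trans q (≈-sym p))
          (Membershipₚ.∈-filter⁺ S P? resp (cover Px) Px))
        (λ x∈ → proj₂ (Membershipₚ.∈-filter⁻ S P? resp {xs = xs}
          (Membershipₚ.∈-deduplicate⁻ S _≟_ (filter P? xs) x∈)))
      where
      _≟_ : ∀ x y → Dec (x ≈ y)
      x ≟ y = decide (x ≈ y)
      P? : ∀ x → Dec (P x)
      P? x = decide (P x)
      decS : DecSetoid 0ℓ 0ℓ
      decS = record { isDecEquivalence = record { isEquivalence = isEquivalence ; _≟_ = _≟_ } }

-- Limits inferior and superior of real sequences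

limInf-limSup : ∀ a ℓ →
  (∀ {q} → below ℓ q → ∃ λ n → ∀ {k} → n ≤ k → below (a k) q) →
  (∀ {p q} → p ℚ.< q → (∀ n → ∃ λ k → n ≤ k × below (a k) q) → below ℓ p) →
  (∃ λ q → ∀ k → below (a k) q) → (∃ λ q → ∀ k → ¬ below (a k) q) →
  IsLimInf a ℓ × IsLimSup a ℓ
-- `eventually` and `frequently` are the two halves of convergence to `ℓ`, expressed by cuts; the
-- uniform bounds `q₋` and `q₊` make the tail infima and suprema real numbers.
limInf-limSup a ℓ eventually frequently (q₋ , a>q₋) (q₊ , a≤q₊) =
  (i , i-inf , (λ { (n , _ , refl) → i≤ℓ n }) , ℓ-least) ,
  (s , s-sup , (λ { (n , _ , refl) → ℓ≤s n }) , ℓ-greatest)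
  where
  i s : ℕ → ℝ
  -- An intersection of open segments need not be open, so a rational strictly above `p` is required
  -- to lie below all terms of the tail. For `s` a union suffices, and it is open already.
  i n = record
    { below     = λ p → ∃ λ q → p ℚ.< q × (∀ {k} → n ≤ k → below (a k) q)
    ; inhabited = let p , p<q₋ = smaller q₋ in p , q₋ , p<q₋ , λ {k} _ → a>q₋ k
    ; bounded   = q₊ , λ (q , p<q , a>q) → a≤q₊ n (ℝ.closed (a n) (ℚ.<⇒≤ p<q) (a>q ℕ.≤-refl))
    ; closed    = λ p≤p′ (q , p′<q , a>q) → q , ℚ.≤-<-trans p≤p′ p′<q , a>q
    ; rounded   = λ (q , p<q , a>q) →
        let p′ , p<p′ , p′<q = ℚ.<-dense p<q in p′ , p<p′ , q , p′<q , a>q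
    }
    where
    smaller : ∀ q → ∃ λ p → p ℚ.< q
    smaller q = q ℚ.- ℚ.1ℚᵘ ,
      ℚ.<-respʳ-≃ (ℚ.+-identityʳ q) (ℚ.+-monoʳ-< q {ℚ.- ℚ.1ℚᵘ} {0ℚᵘ} (*<* -<+))
  s n = record
    { below     = λ p → ∃ λ k → n ≤ k × below (a k) p
    ; inhabited = q₋ , n , ℕ.≤-refl , a>q₋ n
    ; bounded   = q₊ , λ (k , _ , a>q₊) → a≤q₊ k a>q₊
    ; closed    = λ p≤q (k , n≤k , a>q) → k , n≤k , ℝ.closed (a k) p≤q a>q
    ; rounded   = λ (k , n≤k , a>p) →
        let q , p<q , a>q = ℝ.rounded (a k) a>p in q , p<q , k , n≤k , a>q
    }

  i-inf : ∀ n → IsInf _≤ᵣ_ (Tail a n) (i n)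
  i-inf n =
    (λ { (k , n≤k , refl) (q , p<q , a>q) → ℝ.closed (a k) (ℚ.<⇒≤ p<q) (a>q n≤k) }) ,
    λ b b≤a b>p → let q , p<q , b>q = ℝ.rounded b b>p in
      q , p<q , λ {k} n≤k → b≤a (k , n≤k , refl) b>q

  s-sup : ∀ n → IsSup _≤ᵣ_ (Tail a n) (s n)
  s-sup n = (λ { (k , n≤k , refl) a>p → k , n≤k , a>p }) ,
    λ b a≤b (k , n≤k , a>p) → a≤b (k , n≤k , refl) a>p

  i≤ℓ : ∀ n → i n ≤ᵣ ℓ
  i≤ℓ n (q , p<q , a>q) =
    frequently p<q λ m → n ⊔ m , ℕ.m≤n⊔m n m , a>q (ℕ.m≤m⊔n n m)

  ℓ-least : ∀ b → (∀ {x} → Image i U x → x ≤ᵣ b) → ℓ ≤ᵣ b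
  ℓ-least b i≤b ℓ>p =
    let q , p<q , ℓ>q = ℝ.rounded ℓ ℓ>p
        n , a>q = eventually ℓ>q
    in i≤b (n , _ , refl) (q , p<q , a>q)

  ℓ≤s : ∀ n → ℓ ≤ᵣ s n
  ℓ≤s n ℓ>p = let m , a>p = eventually ℓ>p in
    n ⊔ m , ℕ.m≤m⊔n n m , a>p (ℕ.m≤n⊔m n m)

  ℓ-greatest : ∀ b → (∀ {x} → Image s U x → b ≤ᵣ x) → b ≤ᵣ ℓ
  ℓ-greatest b b≤s b>p = let q , p<q , b>q = ℝ.rounded b b>p in
    frequently p<q λ n → b≤s (n , _ , refl) b>q

-- Growth of integer powers

n<m^n : ∀ m → .{{NonTrivial m}} → ∀ n → n < m ^ n
n<m^n m n = ℕ.<-≤-trans (Logarithm.n<2^n 0 n) (ℕ.^-monoˡ-≤ n (nonTrivial⇒n>1 m))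

^-cancel-≤ : ∀ {a b} k → .{{NonZero k}} → a ^ k ≤ b ^ k → a ≤ b
^-cancel-≤ k le = ℕ.≮⇒≥ λ b<a → ℕ.<⇒≱ (ℕ.^-monoˡ-< k b<a) le

^-swap : ∀ m i j k l → i * j ≡ k * l → (m ^ i) ^ j ≡ (m ^ k) ^ l
^-swap m i j k l eq =
  trans (ℕ.^-*-assoc m i j) (trans (cong (m ^_) eq) (sym (ℕ.^-*-assoc m k l)))

^-distrib-* : ∀ x y k → (x * y) ^ k ≡ x ^ k * y ^ k
^-distrib-* x y zero    = refl
^-distrib-* x y (suc k) = trans (cong (x * y *_) (^-distrib-* x y k)) (swap x y (x ^ k) (y ^ k))
  where
  swap : ∀ a b c d → (a * b) * (c * d) ≡ (a * c) * (b * d)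
  swap = solve-∀

-- By `doubling`, the ratio of `suc a ^ n` to `a ^ n` at least doubles whenever n grows by `suc a`;
-- after `K` such blocks it is at least 2ᴷ, which exceeds `K`. For a = 0 the left side vanishes from
-- n = 1 on.
multiple-^ : ∀ K a → ∃ λ n₀ → ∀ {n} → n₀ ≤ n → K * a ^ n ≤ suc a ^ n
multiple-^ K zero = 1 , λ { (s≤s _) →
  ℕ.≤-trans (ℕ.≤-reflexive (ℕ.*-zeroʳ K)) z≤n }
multiple-^ K a@(suc _) = N * K , λ N*K≤n → let j , eq = ℕ.m≤n⇒∃[o]m+o≡n N*K≤n in
  subst (λ n → K * a ^ n ≤ suc a ^ n) eq (scaled j)
  where
  N = suc a
  scaled : ∀ j → K * a ^ (N * K + j) ≤ suc a ^ (N * K + j)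
  scaled j = begin
    K * a ^ (N * K + j)                ≡⟨ cong (K *_) (ℕ.^-distribˡ-+-* a (N * K) j) ⟩
    K * (a ^ (N * K) * a ^ j)          ≡⟨ ℕ.*-assoc K _ _ ⟨
    K * a ^ (N * K) * a ^ j            ≡⟨ cong (λ x → K * x * a ^ j) (ℕ.^-*-assoc a N K) ⟨
    K * (a ^ N) ^ K * a ^ j            ≤⟨ ℕ.*-monoˡ-≤ (a ^ j) (ℕ.*-monoˡ-≤ ((a ^ N) ^ K) (ℕ.<⇒≤ (n<m^n 2 K))) ⟩
    2 ^ K * (a ^ N) ^ K * a ^ j        ≡⟨ cong (_* a ^ j) (^-distrib-* 2 (a ^ N) K) ⟨
    (2 * a ^ N) ^ K * a ^ j            ≤⟨ ℕ.*-mono-≤ (ℕ.^-monoˡ-≤ K (ℕ.<⇒≤ (Logarithm.doubling 0 a))) (ℕ.^-monoˡ-≤ j (ℕ.n≤1+n a)) ⟩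
    (suc a ^ N) ^ K * suc a ^ j        ≡⟨ cong (_* suc a ^ j) (ℕ.^-*-assoc (suc a) N K) ⟩
    suc a ^ (N * K) * suc a ^ j        ≡⟨ ℕ.^-distribˡ-+-* (suc a) (N * K) j ⟨
    suc a ^ (N * K + j)                ∎

bracket : ∀ ν → .{{NonTrivial ν}} → ∀ K → .{{NonZero K}} → ∀ n₀ {r} → K * ν ^ n₀ ≤ r →
  ∃ λ n → n₀ ≤ n × K * ν ^ n ≤ r × r < K * ν ^ suc n
bracket ν K n₀ {r} le = search (suc r) n₀ ℕ.≤-refl le (ℕ.m≤m+n (suc r) n₀)
  where
  -- `k` is fuel. It cannot run out, since n < νⁿ ≤ r holds as long as the search goes on.
  search : ∀ k n → n₀ ≤ n → K * ν ^ n ≤ r → r < k + n →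
           ∃ λ n → n₀ ≤ n × K * ν ^ n ≤ r × r < K * ν ^ suc n
  search zero n _ le r<n = contradiction (begin-strict
    r          <⟨ r<n ⟩
    n          <⟨ n<m^n ν n ⟩
    ν ^ n      ≤⟨ ℕ.m≤n*m (ν ^ n) K ⟩
    K * ν ^ n  ≤⟨ le ⟩
    r          ∎) (ℕ.<-irrefl refl)
  search (suc k) n n₀≤n le r<k+n with r ℕ.<? K * ν ^ suc n
  ... | yes lt = n , n₀≤n , le , lt
  ... | no ¬lt = search k (suc n) (ℕ.m≤n⇒m≤1+n n₀≤n) (ℕ.≮⇒≥ ¬lt) (subst (r <_) (sym (ℕ.+-suc k n)) r<k+n)

-- Quotients of logarithms in terms of integer powers

module _ (m r : ℕ) {{_ : NonTrivial r}} where

  open Quotient (log m) (log r) using (BelowQuotient)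

  private
    -- Serves as `lo` in every quotient: 2 < 4 ≤ r² puts it below log r for all r ≥ 2.
    ½ : ℚᵘ
    ½ = mkℚᵘ (+ 1) 1

    0<½ : 0ℚᵘ ℚ.< ½
    0<½ = *<* (+<+ (s≤s z≤n))

    ½<log : below (log r) ½
    ½<log = begin-strict
      2          <⟨ s≤s (s≤s (s≤s z≤n)) ⟩
      4          ≤⟨ ℕ.^-monoˡ-≤ 2 (nonTrivial⇒n>1 r) ⟩
      r ^ 2      ∎

    ½≤ : ∀ {hi} → ¬ below (log r) hi → ½ ℚ.≤ hi
    ½≤ hi≮ = ℚ.≮⇒≥ λ hi<½ → hi≮ (ℝ.closed (log r) (ℚ.<⇒≤ hi<½) ½<log)

  -- Multiplying by a negative q reverses ½ ≤ hi, so q · ½ bounds both products; being negative, it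
  -- lies below every logarithm.
  belowQuotient-neg : ∀ n d → BelowQuotient (mkℚᵘ -[1+ n ] d)
  belowQuotient-neg n d = record
    { s      = mkℚᵘ -[1+ n ] d ℚ.* ½
    ; hi     = mkℚᵘ (+ r) 0
    ; s<x    = tt
    ; 0<lo   = 0<½
    ; lo<y   = ½<log
    ; hi≮y   = proj₂ (ℝ.bounded (log r))
    ; q·lo≤s = ℚ.≤-refl
    ; q·hi≤s = ℚ.*-monoʳ-≤-nonPos (mkℚᵘ -[1+ n ] d) (½≤ {mkℚᵘ (+ r) 0} (proj₂ (ℝ.bounded (log r))))
    }

  -- Together with `belowQuotient⁺` this replaces p/d < log m / log r by rᵖ < mᵈ, so that the growth
  -- estimates need only natural numbers. If mᵈ ≤ rᵖ, clearing denominators in q · hi ≤ s, with log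
  -- r ≤ hi and s < log m, would make a number smaller than itself.
  belowQuotient⁻ : ∀ {p d} → BelowQuotient (mkℚᵘ (+ p) d) → r ^ p < m ^ suc d
  belowQuotient⁻ {p} {d} record { s = s ; hi = hi ; s<x = s<x ; hi≮y = hi≮y ; q·hi≤s = q·hi≤s } =
    compare s hi s<x hi≮y q·hi≤s
    where
    rearrange₁ : ∀ d T D → d * (T * D) ≡ T * (d * D)
    rearrange₁ = solve-∀
    rearrange₂ : ∀ p T D → p * (T * D) ≡ D * (p * T)
    rearrange₂ = solve-∀
    rearrange₃ : ∀ P p T → P * (p * T) ≡ p * P * T
    rearrange₃ = solve-∀
    pos-** : ∀ i j k → + i ℤ.* + j ℤ.* + k ≡ + (i * j * k)
    pos-** i j k = trans (cong (ℤ._* + k) (sym (ℤ.pos-* i j))) (sym (ℤ.pos-* (i * j) k))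
    compare : ∀ s hi → below (log m) s → ¬ below (log r) hi → mkℚᵘ (+ p) d ℚ.* hi ℚ.≤ s → r ^ p < m ^ suc d
    compare s                (mkℚᵘ -[1+ _ ] _) _   hi≮ _ = contradiction tt hi≮
    compare (mkℚᵘ -[1+ n ] t) (mkℚᵘ (+ P) D) _ _ (*≤* le)
      with () ← subst (ℤ._≤ _) (pos-** p P (suc t)) le
    compare (mkℚᵘ (+ S) t) (mkℚᵘ (+ P) D-1) 2^S<m^T hi≮ (*≤* le) =
      ℕ.≰⇒> λ m^d≤r^p → ℕ.<-irrefl refl (begin-strict
        (m ^ T) ^ (suc d * D)    ≡⟨ ^-swap m T (suc d * D) (suc d) (T * D) (sym (rearrange₁ (suc d) T D)) ⟩
        (m ^ suc d) ^ (T * D)    ≤⟨ ℕ.^-monoˡ-≤ (T * D) m^d≤r^p ⟩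
        (r ^ p) ^ (T * D)        ≡⟨ ^-swap r p (T * D) D (p * T) (rearrange₂ p T D) ⟩
        (r ^ D) ^ (p * T)        ≤⟨ ℕ.^-monoˡ-≤ (p * T) (ℕ.≮⇒≥ hi≮) ⟩
        (2 ^ P) ^ (p * T)        ≡⟨ ℕ.^-*-assoc 2 P (p * T) ⟩
        2 ^ (P * (p * T))        ≡⟨ cong (2 ^_) (rearrange₃ P p T) ⟩
        2 ^ (p * P * T)          ≤⟨ ℕ.^-monoʳ-≤ 2 (ℤ.drop‿+≤+ le′) ⟩
        2 ^ (S * (suc d * D))    ≡⟨ ℕ.^-*-assoc 2 S (suc d * D) ⟨
        (2 ^ S) ^ (suc d * D)    <⟨ ℕ.^-monoˡ-< (suc d * D) 2^S<m^T ⟩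
        (m ^ T) ^ (suc d * D)    ∎)
      where
      T = suc t
      D = suc D-1
      le′ : + (p * P * T) ℤ.≤ + (S * (suc d * D))
      le′ = subst₂ ℤ._≤_ (pos-** p P T) (sym (ℤ.pos-* S (suc d * D))) le

  belowQuotient⁺ : ∀ {p d} → r ^ p < m ^ suc d → BelowQuotient (mkℚᵘ (+ p) d)
  belowQuotient⁺ {p} {d} r^p<m^d = record
    { s      = s
    ; s<x    = s<log
    ; 0<lo   = 0<½
    ; lo<y   = ½<log
    ; hi≮y   = hi≮log
    ; q·lo≤s = ℚ.≤-trans (ℚ.*-monoʳ-≤-nonNeg q (½≤ hi≮log)) q·hi≤s
    ; q·hi≤s = q·hi≤s
    }
    where
    q = mkℚᵘ (+ p) d
    rᵖ = r ^ p
    instance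
      r≢0 : NonZero r
      r≢0 = nonTrivial⇒nonZero r
      rᵖ≢0 : NonZero rᵖ
      rᵖ≢0 = ℕ.m^n≢0 r p
    -- The rounding in hi costs a factor of at most 2ᵖ, which
    -- (rᵖ + 1)ᴰ / (rᵖ)ᴰ exceeds for this choice of D.
    n₀ = proj₁ (multiple-^ (suc (2 ^ p)) rᵖ)
    D = suc n₀
    -- The integer part of D · log₂ r. Adding one gives the numerator `P` of `hi`, which therefore
    -- exceeds log₂ r by at most 1/D.
    approx : ∃ λ P → 0 ≤ P × 1 * 2 ^ P ≤ r ^ D × r ^ D < 1 * 2 ^ suc P
    approx = bracket 2 1 0 (ℕ.m^n>0 r D)
    P = suc (proj₁ approx)
    hi = mkℚᵘ (+ P) n₀
    s = mkℚᵘ (+ (p * P)) (n₀ + d * D)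
    hi≮log : ¬ below (log r) hi
    hi≮log 2^P<r^D = ℕ.<-asym 2^P<r^D
      (subst (r ^ D <_) (ℕ.*-identityˡ (2 ^ P)) (proj₂ (proj₂ (proj₂ approx))))
    2^P≤ : 2 ^ P ≤ 2 * r ^ D
    2^P≤ = ℕ.*-monoʳ-≤ 2 (subst (_≤ r ^ D) (ℕ.*-identityˡ _) (proj₁ (proj₂ (proj₂ approx))))
    s<log : 2 ^ (p * P) < m ^ (suc d * D)
    s<log = begin-strict
      2 ^ (p * P)           ≡⟨ cong (2 ^_) (ℕ.*-comm p P) ⟩
      2 ^ (P * p)           ≡⟨ ℕ.^-*-assoc 2 P p ⟨
      (2 ^ P) ^ p           ≤⟨ ℕ.^-monoˡ-≤ p 2^P≤ ⟩
      (2 * r ^ D) ^ p       ≡⟨ ^-distrib-* 2 (r ^ D) p ⟩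
      2 ^ p * (r ^ D) ^ p   ≡⟨ cong (2 ^ p *_) (^-swap r D p p D (ℕ.*-comm D p)) ⟩
      2 ^ p * rᵖ ^ D         <⟨ ℕ.*-monoˡ-< (rᵖ ^ D) {{ℕ.m^n≢0 rᵖ D}} (ℕ.n<1+n (2 ^ p)) ⟩
      suc (2 ^ p) * rᵖ ^ D   ≤⟨ proj₂ (multiple-^ (suc (2 ^ p)) rᵖ) (ℕ.n≤1+n n₀) ⟩
      suc rᵖ ^ D             ≤⟨ ℕ.^-monoˡ-≤ D r^p<m^d ⟩
      (m ^ suc d) ^ D       ≡⟨ ℕ.^-*-assoc m (suc d) D ⟩
      m ^ (suc d * D)       ∎
    q·hi≤s : q ℚ.* hi ℚ.≤ s
    q·hi≤s = *≤* (ℤ.≤-reflexive (cong (ℤ._* + suc (n₀ + d * D)) (sym (ℤ.pos-* p P))))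

-- Growth exponents of functions comparable to a power

-- The hypotheses say that f(r) is r to the power log μ / log ν, up to
-- constant factors.
module PowerGrowth (ν μ : ℕ) {{_ : NonTrivial ν}} (f : ℕ → ℕ)
  (K : ℕ) {{_ : NonZero K}} (f-lower : ∀ {n r} → K * ν ^ n ≤ r → μ ^ n ≤ f r)
  (L : ℕ) (f-upper : ∀ {n r} → r ≤ ν ^ n → f r ≤ L * μ ^ n) where

  private instance
    ν≢0 : NonZero ν
    ν≢0 = nonTrivial⇒nonZero ν

  -- Replacing r by the next K · νⁿ⁺¹ costs only the constant factor (K · ν)ᵖ, which the strict gap
  -- between νᵖ and μᵈ absorbs for large n by `multiple-^`.
  eventually-above : ∀ p d → ν ^ p < μ ^ d → ∃ λ r₀ → ∀ {r} → r₀ ≤ r → r ^ p < f r ^ d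
  eventually-above p d lt = K * ν ^ n₀ , λ {r} r₀≤r →
    let n , n₀≤n , le , gt = bracket ν K n₀ r₀≤r in begin-strict
      r ^ p                          ≤⟨ ℕ.^-monoˡ-≤ p (ℕ.<⇒≤ gt) ⟩
      (K * (ν * ν ^ n)) ^ p          ≡⟨ cong (_^ p) (ℕ.*-assoc K ν (ν ^ n)) ⟨
      (K * ν * ν ^ n) ^ p            ≡⟨ ^-distrib-* (K * ν) (ν ^ n) p ⟩
      (K * ν) ^ p * (ν ^ n) ^ p      ≡⟨ cong ((K * ν) ^ p *_) (^-swap ν n p p n (ℕ.*-comm n p)) ⟩
      (K * ν) ^ p * (ν ^ p) ^ n      <⟨ ℕ.*-monoˡ-< ((ν ^ p) ^ n) {{ℕ.m^n≢0 (ν ^ p) n {{ℕ.m^n≢0 ν p}}}} (ℕ.n<1+n ((K * ν) ^ p)) ⟩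
      suc ((K * ν) ^ p) * (ν ^ p) ^ n  ≤⟨ proj₂ (multiple-^ (suc ((K * ν) ^ p)) (ν ^ p)) n₀≤n ⟩
      suc (ν ^ p) ^ n                ≤⟨ ℕ.^-monoˡ-≤ n lt ⟩
      (μ ^ d) ^ n                    ≡⟨ ^-swap μ d n n d (ℕ.*-comm d n) ⟩
      (μ ^ n) ^ d                    ≤⟨ ℕ.^-monoˡ-≤ d (f-lower {n} le) ⟩
      f r ^ d                        ∎
    where n₀ = proj₁ (multiple-^ (suc ((K * ν) ^ p)) (ν ^ p))

  -- The strict inequality p/d < p′/d′ leaves a spare factor νⁿ. It absorbs the constant `M`,
  -- because M < νᴹ ≤ νⁿ once n ≥ M.
  eventually-below : ∀ p d p′ d′ → .{{NonZero d}} → μ ^ d ≤ ν ^ p → p * d′ < p′ * d →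
    ∃ λ r₀ → ∀ {r} → r₀ ≤ r → f r ^ d′ ≤ r ^ p′
  eventually-below p d p′ d′ μ^d≤ν^p lt = 1 * ν ^ M , λ {r} r₀≤r →
    let n , M≤n , le , gt = bracket ν 1 M r₀≤r in ^-cancel-≤ d (begin
      (f r ^ d′) ^ d                     ≤⟨ ℕ.^-monoˡ-≤ d (ℕ.^-monoˡ-≤ d′ (f-upper {suc n}
                                              (ℕ.≤-trans (ℕ.<⇒≤ gt) (ℕ.≤-reflexive (ℕ.*-identityˡ _))))) ⟩
      ((L * μ ^ suc n) ^ d′) ^ d         ≡⟨ ℕ.^-*-assoc _ d′ d ⟩
      (L * μ ^ suc n) ^ (d′ * d)         ≡⟨ ^-distrib-* L (μ ^ suc n) (d′ * d) ⟩
      L ^ (d′ * d) * (μ ^ suc n) ^ (d′ * d)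
        ≡⟨ cong (L ^ (d′ * d) *_) (^-swap μ (suc n) (d′ * d) d (suc n * d′) (rearrange₁ (suc n) d′ d)) ⟩
      L ^ (d′ * d) * (μ ^ d) ^ (suc n * d′)
        ≤⟨ ℕ.*-monoʳ-≤ (L ^ (d′ * d)) (ℕ.^-monoˡ-≤ (suc n * d′) μ^d≤ν^p) ⟩
      L ^ (d′ * d) * (ν ^ p) ^ (suc n * d′)
        ≡⟨ cong (L ^ (d′ * d) *_) (trans (ℕ.^-*-assoc ν p (suc n * d′)) (trans (cong (ν ^_) (rearrange₂ p n d′))
             (ℕ.^-distribˡ-+-* ν (p * d′) (n * (p * d′))))) ⟩
      L ^ (d′ * d) * (ν ^ (p * d′) * ν ^ (n * (p * d′)))
        ≡⟨ ℕ.*-assoc (L ^ (d′ * d)) _ _ ⟨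
      M * ν ^ (n * (p * d′))             ≤⟨ ℕ.*-monoˡ-≤ _ (ℕ.<⇒≤ (n<m^n ν M)) ⟩
      ν ^ M * ν ^ (n * (p * d′))         ≤⟨ ℕ.*-monoˡ-≤ _ (ℕ.^-monoʳ-≤ ν M≤n) ⟩
      ν ^ n * ν ^ (n * (p * d′))         ≡⟨ ℕ.^-distribˡ-+-* ν n _ ⟨
      ν ^ (n + n * (p * d′))             ≡⟨ cong (ν ^_) (sym (ℕ.*-suc n (p * d′))) ⟩
      ν ^ (n * suc (p * d′))             ≤⟨ ℕ.^-monoʳ-≤ ν (ℕ.*-monoʳ-≤ n lt) ⟩
      ν ^ (n * (p′ * d))                 ≡⟨ ℕ.^-*-assoc ν n (p′ * d) ⟨
      (ν ^ n) ^ (p′ * d)                 ≤⟨ ℕ.^-monoˡ-≤ (p′ * d) (ℕ.≤-trans (ℕ.≤-reflexive (sym (ℕ.*-identityˡ _))) le) ⟩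
      r ^ (p′ * d)                       ≡⟨ ℕ.^-*-assoc r p′ d ⟨
      (r ^ p′) ^ d                       ∎)
    where
    M = L ^ (d′ * d) * ν ^ (p * d′)
    rearrange₁ : ∀ n d′ d → n * (d′ * d) ≡ d * (n * d′)
    rearrange₁ = solve-∀
    rearrange₂ : ∀ p n d′ → p * (suc n * d′) ≡ p * d′ + n * (p * d′)
    rearrange₂ = solve-∀

  -- Gives one upper bound for all growth exponents. Constants are turned into powers by L < rᴸ, μ <
  -- ν^μ and ν < r^ν.
  polynomial-bound : ∃ λ e → ∀ r → .{{NonTrivial r}} → f r ≤ r ^ e
  polynomial-bound = (L + (ν * μ + μ)) , λ r → 
    let r>1 = nonTrivial⇒n>1 r
        n , _ , le , gt = bracket ν 1 0 {r} (ℕ.<⇒≤ r>1)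
    in begin
      f r                                ≤⟨ f-upper {suc n} (ℕ.≤-trans (ℕ.<⇒≤ gt) (ℕ.≤-reflexive (ℕ.*-identityˡ _))) ⟩
      L * μ ^ suc n                      ≤⟨ ℕ.*-mono-≤ (ℕ.<⇒≤ (n<m^n r L)) (ℕ.^-monoˡ-≤ (suc n) (ℕ.<⇒≤ (n<m^n ν μ))) ⟩
      r ^ L * (ν ^ μ) ^ suc n            ≡⟨ cong (r ^ L *_) (^-swap ν μ (suc n) (suc n) μ (ℕ.*-comm μ (suc n))) ⟩
      r ^ L * (ν * ν ^ n) ^ μ            ≡⟨ cong (r ^ L *_) (^-distrib-* ν (ν ^ n) μ) ⟩
      r ^ L * (ν ^ μ * (ν ^ n) ^ μ)      ≤⟨ ℕ.*-monoʳ-≤ (r ^ L) (ℕ.*-mono-≤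
                                              (ℕ.≤-trans (ℕ.^-monoˡ-≤ μ (ℕ.<⇒≤ (n<m^n r ν))) (ℕ.≤-reflexive (ℕ.^-*-assoc r ν μ)))
                                              (ℕ.^-monoˡ-≤ μ (ℕ.≤-trans (ℕ.≤-reflexive (sym (ℕ.*-identityˡ _))) le))) ⟩
      r ^ L * (r ^ (ν * μ) * r ^ μ)      ≡⟨ cong (r ^ L *_) (ℕ.^-distribˡ-+-* r (ν * μ) μ) ⟨
      r ^ L * r ^ (ν * μ + μ)            ≡⟨ ℕ.^-distribˡ-+-* r L (ν * μ + μ) ⟨
      r ^ (L + (ν * μ + μ))              ∎

  private
    exponent : ℕ → ℝ
    exponent k = log (f (2 + k)) / log (2 + k)

  growthExponent-limits : IsLimInf exponent (log μ / log ν) × IsLimSup exponent (log μ / log ν)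
  growthExponent-limits = limInf-limSup exponent (log μ / log ν) eventually frequently
    (mkℚᵘ -[1+ 0 ] 0 , λ k → belowQuotient-neg (f (2 + k)) (2 + k) 0 0)
    (mkℚᵘ (+ e) 0 , λ k b → ℕ.<⇒≱ (belowQuotient⁻ (f (2 + k)) (2 + k) b)
       (ℕ.≤-trans (ℕ.≤-reflexive (ℕ.*-identityʳ _)) (proj₂ polynomial-bound (2 + k))))
    where
    e = proj₁ polynomial-bound
    eventually : ∀ {q} → below (log μ / log ν) q → ∃ λ n → ∀ {k} → n ≤ k → below (exponent k) q
    eventually {mkℚᵘ -[1+ n ] d} _ = 0 , λ {k} _ → belowQuotient-neg (f (2 + k)) (2 + k) n d
    eventually {mkℚᵘ (+ p) d} b =
      let r₀ , above = eventually-above p (suc d) (belowQuotient⁻ μ ν b) in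
      r₀ , λ {k} r₀≤k → belowQuotient⁺ (f (2 + k)) (2 + k) (above (ℕ.≤-trans r₀≤k (ℕ.m≤n+m k 2)))
    frequently : ∀ {p q} → p ℚ.< q → (∀ n → ∃ λ k → n ≤ k × below (exponent k) q) → below (log μ / log ν) p
    frequently {mkℚᵘ -[1+ n ] d} _ _ = belowQuotient-neg μ ν n d
    frequently {mkℚᵘ (+ p) d} {mkℚᵘ -[1+ _ ] _} (*<* lt) _
      with () ← subst (ℤ._< _) (sym (ℤ.pos-* p _)) lt
    frequently {mkℚᵘ (+ p) d} {mkℚᵘ (+ p′) d′} (*<* lt) often with ν ^ p ℕ.<? μ ^ suc d
    ... | yes above = belowQuotient⁺ μ ν above
    -- Here log μ / log ν ≤ p/d, so the exponents are eventually at most q, against the assumption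
    -- that q lies below them infinitely often.
    ... | no ¬above =
      let r₀ , below′ = eventually-below p (suc d) p′ (suc d′) (ℕ.≮⇒≥ ¬above)
            (ℤ.drop‿+<+ (subst₂ ℤ._<_ (sym (ℤ.pos-* p (suc d′))) (sym (ℤ.pos-* p′ (suc d))) lt))
          k , r₀≤k , b = often r₀
      in contradiction (below′ (ℕ.≤-trans r₀≤k (ℕ.m≤n+m k 2)))
           (ℕ.<⇒≱ (belowQuotient⁻ (f (2 + k)) (2 + k) b))

-- Lengths of walks

steps-◅◅ : ∀ {A : Set} {R : A → A → Set} {x y z} (p : Star R x y) (q : Star R y z) →
  steps (p ◅◅ q) ≡ steps p + steps q
steps-◅◅ ε       q = refl
steps-◅◅ (_ ◅ p) q = cong suc (steps-◅◅ p q)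

steps-snoc : ∀ {A : Set} {R : A → A → Set} {x y z} (p : Star R x y) (e : R y z) →
  steps (p ◅◅ (e ◅ ε)) ≡ suc (steps p)
steps-snoc p e = trans (steps-◅◅ p (e ◅ ε)) (ℕ.+-comm (steps p) 1)

-- Cells, their boundaries and the axioms in terms of representatives

module SelfSimilar (em : ExcludedMiddle (lsuc 0ℓ)) (X : Graph) (F : Pred (Graph.V X) 0ℓ)
  (ψ : Graph.V X → Graph.V X) (hss : IsHomogeneouslySelfSimilar X F ψ)
  {ν : ℕ} {{ν≥2 : NonTrivial ν}} (scaling : IsLengthScalingFactor X F ν) where

  open Graph X
  open IsHomogeneouslySelfSimilar hss
  open Classical em

  -- Cells are represented by vertices outside F: x and y represent the
  -- same cell iff x ≈ y.
  infix 4 _≈_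
  _≈_ : V → V → Set
  _≈_ = Star (Step X (∁ F))

  cell : V → Pred V 0ℓ
  cell c = c ≈_

  ≈-sym : ∀ {x y} → x ≈ y → y ≈ x
  ≈-sym = reverse λ (x∉F , y∉F , x~y) → y∉F , x∉F , ~-sym x~y

  cellSetoid : Setoid 0ℓ 0ℓ
  cellSetoid = record
    { _≈_ = _≈_ ; isEquivalence = record { refl = ε ; sym = ≈-sym ; trans = _◅◅_ } }

  ≈-∉F : ∀ {x y} → ¬ F x → x ≈ y → ¬ F y
  ≈-∉F x∉F ε                     = x∉F
  ≈-∉F _   ((_ , y∉F , _) ◅ x≈y) = ≈-∉F y∉F x≈y

  ~⇒≈ : ∀ {x y} → ¬ F x → ¬ F y → x ~ y → x ≈ y
  ~⇒≈ x∉F y∉F x~y = (x∉F , y∉F , x~y) ◅ ε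

  cell-isCell : ∀ {c} → ¬ F c → IsCell X F (cell c)
  cell-isCell c∉F = _ , c∉F , id , id

  -- For c ∉ F this is the boundary of the cell of c: a neighbour of the cell lies outside the cell
  -- exactly when it lies in F.
  θ : V → Pred V 0ℓ
  θ c f = F f × ∃ λ u → c ≈ u × u ~ f

  Cl : V → Pred V 0ℓ
  Cl c x = c ≈ x ⊎ θ c x

  θ-resp : ∀ {c d f} → c ≈ d → θ c f → θ d f
  θ-resp c≈d (f∈F , u , c≈u , u~f) = f∈F , u , ≈-sym c≈d ◅◅ c≈u , u~f

  θ⇒boundary : ∀ {c} → ¬ F c → θ c ⊆ boundary X (cell c)
  θ⇒boundary c∉F (f∈F , u , c≈u , u~f) = (λ c≈f → ≈-∉F c∉F c≈f f∈F) , u , c≈u , u~f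

  boundary⇒θ : ∀ {c C} → ¬ F c → C ≐ cell c → boundary X C ⊆ θ c
  boundary⇒θ c∉F (C⊆ , ⊆C) (f∉C , u , u∈C , u~f) =
    ¬¬-elim (λ f∉F → f∉C (⊆C (C⊆ u∈C ◅◅ ~⇒≈ (≈-∉F c∉F (C⊆ u∈C)) f∉F u~f))) ,
    u , C⊆ u∈C , u~f

  Cl⇒closure : ∀ {c} → ¬ F c → Cl c ⊆ closure X (cell c)
  Cl⇒closure c∉F (inj₁ c≈x) = inj₁ c≈x
  Cl⇒closure c∉F (inj₂ x∈θ) = inj₂ (θ⇒boundary c∉F x∈θ)

  closure⇒Cl : ∀ {c} → ¬ F c → closure X (cell c) ⊆ Cl c
  closure⇒Cl c∉F (inj₁ c≈x) = inj₁ c≈x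
  closure⇒Cl c∉F (inj₂ x∈θ) = inj₂ (boundary⇒θ c∉F (id , id) x∈θ)

  Cl-~ : ∀ {c x y} → c ≈ x → ¬ F x → x ~ y → Cl c y
  Cl-~ {y = y} c≈x x∉F x~y with decide (F y)
  ... | yes y∈F = inj₂ (y∈F , _ , c≈x , x~y)
  ... | no y∉F  = inj₁ (c≈x ◅◅ ~⇒≈ x∉F y∉F x~y)

  record CellIso (c d : V) : Set where
    field
      α       : V → V
      α-Cl    : ∀ {x} → Cl c x → Cl d (α x)
      α-θ     : ∀ {f} → θ c f → θ d (α f)
      α-inj   : ∀ {x y} → Cl c x → Cl c y → α x ≡ α y → x ≡ y
      α-surj  : ∀ {z} → Cl d z → ∃ λ x → Cl c x × z ≡ α x
      α-surjθ : ∀ {g} → θ d g → ∃ λ f → θ c f × g ≡ α f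
      α-~     : ∀ {x y} → Cl c x → Cl c y → x ~ y → α x ~ α y
      α-~⁻    : ∀ {x y} → Cl c x → Cl c y → α x ~ α y → x ~ y

  cellIso : ∀ {c d} → ¬ F c → ¬ F d → CellIso c d
  cellIso {c} {d} c∉F d∉F
    with α , iso , θ⊆ , ⊆θ ← H1-isomorphic (cell-isCell c∉F) (cell-isCell d∉F) = record
    { α       = α
    ; α-Cl    = λ x∈ → closure⇒Cl d∉F (maps (Cl⇒closure c∉F x∈))
    ; α-θ     = λ f∈ → boundary⇒θ d∉F (id , id) (θ⊆ (_ , θ⇒boundary c∉F f∈ , refl))
    ; α-inj   = λ x∈ y∈ → injective (Cl⇒closure c∉F x∈) (Cl⇒closure c∉F y∈)
    ; α-surj  = λ z∈ → let x , x∈ , eq = surjective (Cl⇒closure d∉F z∈) in x , closure⇒Cl c∉F x∈ , eq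
    ; α-surjθ = λ g∈ → let f , f∈ , eq = ⊆θ (θ⇒boundary d∉F g∈) in f , boundary⇒θ c∉F (id , id) f∈ , eq
    ; α-~     = λ x∈ y∈ → to (adjacency (Cl⇒closure c∉F x∈) (Cl⇒closure c∉F y∈))
    ; α-~⁻    = λ x∈ y∈ → from (adjacency (Cl⇒closure c∉F x∈) (Cl⇒closure c∉F y∈))
    }
    where open IsIsomorphism iso

  module F3 = IsIsomorphism F3

  ψ∈F : ∀ x → F (ψ x)
  ψ∈F x = F3.maps {x} _

  ψ-inj : ∀ {x y} → ψ x ≡ ψ y → x ≡ y
  ψ-inj = F3.injective _ _

  F⇒ψ : ∀ {f} → F f → ∃ λ x → f ≡ ψ x
  F⇒ψ f∈F = let x , _ , eq = F3.surjective f∈F in x , eq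

  θ-ψ⇒~ : ∀ {c x y} → ¬ F c → θ c (ψ x) → θ c (ψ y) → x ≢ y → x ~ y
  θ-ψ⇒~ c∉F x∈θ y∈θ x≢y = from (F3.adjacency _ _)
    (x≢y ∘ ψ-inj , _ , cell-isCell c∉F , θ⇒boundary c∉F x∈θ , θ⇒boundary c∉F y∈θ)

  ~⇒θ-ψ : ∀ {x y} → x ~ y → ψ x ≢ ψ y × ∃ λ c → ¬ F c × θ c (ψ x) × θ c (ψ y)
  ~⇒θ-ψ x~y with ψx≢ψy , C , (c , c∉F , C≐) , x∈∂ , y∈∂ ← to (F3.adjacency _ _) x~y =
    ψx≢ψy , c , c∉F , boundary⇒θ c∉F C≐ x∈∂ , boundary⇒θ c∉F C≐ y∈∂

  shared-pair⇒≈ : ∀ {c d f g} → ¬ F c → ¬ F d → f ≢ g →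
    θ c f → θ c g → θ d f → θ d g → c ≈ d
  shared-pair⇒≈ c∉F d∉F f≢g cf cg df dg = ¬¬-elim λ c≉d →
    f≢g (F2 (cell-isCell c∉F) (cell-isCell d∉F) (λ (_ , d⊆c) → c≉d (d⊆c ε))
      (Cl⇒closure c∉F (inj₂ cf)) (Cl⇒closure d∉F (inj₂ df))
      (Cl⇒closure c∉F (inj₂ cg)) (Cl⇒closure d∉F (inj₂ dg)))

  c₀ : V
  c₀ = proj₁ (proj₁ (proj₂ scaling))

  c₀∉F : ¬ F c₀
  c₀∉F = proj₁ (proj₂ (proj₁ (proj₂ scaling)))

  private
    base-boundary : ∃₂ λ v w → θ c₀ v × θ c₀ w × v ≢ w × IsDistance X v w ν
    base-boundary = let C , (c , c∉F , C≐) , v , w , v∈ , w∈ , v≢w , d = scaling in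
      v , w , boundary⇒θ c∉F C≐ v∈ , boundary⇒θ c∉F C≐ w∈ , v≢w , d

  -- Recomputing the proof of c ∉ F makes the chart depend on c only.
  chart : ∀ c → .(¬ F c) → CellIso c₀ c
  chart c c∉F = cellIso c₀∉F (recompute (decide (¬ F c)) c∉F)

  two-boundary-vertices : ∀ {c} → ¬ F c → ∃₂ λ f g → θ c f × θ c g × f ≢ g
  two-boundary-vertices {c} c∉F with v , w , v∈ , w∈ , v≢w , _ ← base-boundary =
    α v , α w , α-θ v∈ , α-θ w∈ , λ eq → v≢w (α-inj (inj₂ v∈) (inj₂ w∈) eq)
    where open CellIso (chart c c∉F)

  -- Distances and balls

  Within : ℕ → V → V → Set
  Within n x y = ∃ λ (w : Star _~_ x y) → steps w ≤ n

  Within-trans : ∀ {m n x y z} → Within m x y → Within n y z → Within (m + n) x z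
  Within-trans {m} {n} (p , p≤) (q , q≤) = p ◅◅ q ,
    subst (_≤ m + n) (sym (steps-◅◅ p q)) (ℕ.+-mono-≤ p≤ q≤)

  ~⇒Within : ∀ {x y} → x ~ y → Within 1 x y
  ~⇒Within x~y = x~y ◅ ε , ℕ.≤-refl

  Within-sym : ∀ {n x y} → Within n x y → Within n y x
  Within-sym (w , w≤n) = let w′ , eq = back w in w′ , subst (_≤ _) (sym eq) w≤n
    where
    back : ∀ {x y} (w : Star _~_ x y) → ∃ λ (w′ : Star _~_ y x) → steps w′ ≡ steps w
    back ε       = ε , refl
    back (e ◅ w) = let w′ , eq = back w in
      w′ ◅◅ (~-sym e ◅ ε) , trans (steps-snoc w′ _) (cong suc eq)

  Within-mono : ∀ {m n x y} → m ≤ n → Within m x y → Within n x y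
  Within-mono m≤n (w , w≤m) = w , ℕ.≤-trans w≤m m≤n

  distance : ∀ x y → ∃ (IsDistance X x y)
  distance x y = let n , w , min = least (λ n → ∃ λ (w : Star _~_ x y) → steps w ≡ n) (_ , connected x y , refl)
    in n , w , λ w → min (w , refl)

  Ball⇒Within : ∀ {x r y} → Ball X x r y → Within r y x
  Ball⇒Within (n , ((w , refl) , _) , n≤r) = w , n≤r

  Within⇒Ball : ∀ {x r y} → Within r y x → Ball X x r y
  Within⇒Ball {x} {r} {y} (w , w≤r) = let n , d = distance y x in n , d , ℕ.≤-trans (proj₂ d w) w≤r

  -- The map ψ multiplies distances by ν

  -- Initial pieces, of a given length, of a walk from f through a cell.
  data Enter (f : V) : V → ℕ → Set where
    enter : ∀ {u} → ¬ F u → f ~ u → Enter f u 1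
    move  : ∀ {u v n} → Enter f u n → ¬ F v → u ~ v → Enter f v (suc n)

  Enter-∉F : ∀ {f u n} → Enter f u n → ¬ F u
  Enter-∉F (enter u∉F _)  = u∉F
  Enter-∉F (move _ u∉F _) = u∉F

  Enter-θ : ∀ {f u n} → F f → Enter f u n → θ u f
  Enter-θ f∈F (enter u∉F f~u)    = f∈F , _ , ε , ~-sym f~u
  Enter-θ f∈F (move p v∉F u~v) = θ-resp (~⇒≈ (Enter-∉F p) v∉F u~v) (Enter-θ f∈F p)

  Enter-≈ : ∀ {f u v n} → Enter f u n → u ≈ v → ∃ (Enter f v)
  Enter-≈ p ε                       = _ , p
  Enter-≈ p ((_ , v∉F , u~v) ◅ v≈w) = Enter-≈ (move p v∉F u~v) v≈w

  -- The lengths of walks between two different vertices of F whose inner vertices all lie in one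
  -- cell.
  Crossing : ℕ → Set
  Crossing n = ∃₂ λ f g → F f × F g × f ≢ g × ∃₂ λ u m → Enter f u m × u ~ g × n ≡ suc m

  module _ {l : ℕ} (l-min : ∀ {n} → Crossing n → l ≤ n) where

    -- The vertices of F on a walk in X form a walk in the reduced graph.
    mutual
      contract : ∀ {x z u v} → u ≡ ψ x → v ≡ ψ z → (w : Star _~_ u v) →
        ∃ λ (w′ : Star _~_ x z) → steps w′ * l ≤ steps w
      contract u≡ψx v≡ψz ε with refl ← ψ-inj (trans (sym u≡ψx) v≡ψz) = ε , z≤n
      contract refl v≡ψz (e ◅ w) = contract-inside (enter (λ y∈F → F1 (ψ∈F _) y∈F e) e) v≡ψz w

      contract-inside : ∀ {x z u v n} → Enter (ψ x) u n → v ≡ ψ z → (w : Star _~_ u v) →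
        ∃ λ (w′ : Star _~_ x z) → steps w′ * l ≤ n + steps w
      contract-inside p refl ε = contradiction (ψ∈F _) (Enter-∉F p)
      contract-inside {x} {n = n} p v≡ψz (_◅_ {j = u′} e w) with decide (F u′)
      ... | no u′∉F = let w′ , le = contract-inside (move p u′∉F e) v≡ψz w in
        w′ , ℕ.≤-trans le (ℕ.≤-reflexive (sym (ℕ.+-suc n (steps w))))
      ... | yes u′∈F with x′ , refl ← F⇒ψ u′∈F with w′ , le ← contract refl v≡ψz w with decide (x ≡ x′)
      -- An excursion that returns to the vertex of F where it began is cut out.
      ...   | yes refl = w′ , ℕ.≤-trans le (ℕ.≤-trans (ℕ.n≤1+n _) (ℕ.m≤n+m (suc (steps w)) n))
      -- The excursion is a crossing of length `suc n`, hence at least `l`; its ends lie on the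
      -- boundary of one cell, so it contributes a single edge.
      ...   | no x≢x′ =
        θ-ψ⇒~ (Enter-∉F p) (Enter-θ (ψ∈F x) p) (u′∈F , _ , ε , e) x≢x′ ◅ w′ ,
        ℕ.≤-trans
          (ℕ.+-mono-≤ (l-min (_ , _ , ψ∈F x , u′∈F , x≢x′ ∘ ψ-inj , _ , n , p , e , refl)) le)
          (ℕ.≤-reflexive (sym (ℕ.+-suc n (steps w))))

  -- The walk is kept inside the closure of the cell, because only such walks are carried along by
  -- cell isomorphisms.
  cell-path : ∀ {c x} → ¬ F c → Cl c x → Star (Step X (Cl c)) c x
  cell-path c∉F (inj₁ c≈x) = inside ε c≈x
    where
    inside : ∀ {c x y} → c ≈ x → x ≈ y → Star (Step X (Cl c)) x y
    inside c≈x ε                         = ε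
    inside c≈x (s@(_ , _ , x~y) ◅ y≈z) =
      (inj₁ c≈x , inj₁ (c≈x ◅◅ (s ◅ ε)) , x~y) ◅ inside (c≈x ◅◅ (s ◅ ε)) y≈z
  cell-path c∉F (inj₂ x∈θ@(_ , u , c≈u , u~x)) =
    cell-path c∉F (inj₁ c≈u) ◅◅ ((inj₁ c≈u , inj₂ x∈θ , u~x) ◅ ε)

  module _ {c d} (iso : CellIso c d) where
    open CellIso iso

    α-path : ∀ {x y} (w : Star (Step X (Cl c)) x y) → ∃ λ (w′ : Star _~_ (α x) (α y)) → steps w′ ≡ steps w
    α-path ε                       = ε , refl
    α-path ((x∈ , y∈ , x~y) ◅ w) = let w′ , eq = α-path w in α-~ x∈ y∈ x~y ◅ w′ , cong suc eq

    α-Enter : ∀ {f u n} → θ c f → c ≈ u → Enter f u n → ∃ λ (w : Star _~_ (α f) (α u)) → steps w ≡ n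
    α-Enter f∈θ c≈u (enter _ f~u)    = α-~ (inj₂ f∈θ) (inj₁ c≈u) f~u ◅ ε , refl
    α-Enter f∈θ c≈v (move p v∉F u~v) =
      let c≈u   = c≈v ◅◅ ~⇒≈ v∉F (Enter-∉F p) (~-sym u~v)
          w , eq = α-Enter f∈θ c≈u p
      in w ◅◅ (α-~ (inj₁ c≈u) (inj₁ c≈v) u~v ◅ ε) ,
         trans (steps-snoc w _) (cong suc eq)

  abstract
    shortest-crossing : ∃ λ l → Crossing l × (∀ {n} → Crossing n → l ≤ n)
    shortest-crossing = least Crossing
      (let f , g , f∈@(f∈F , u , c≈u , u~f) , (g∈F , u′ , c≈u′ , u′~g) , f≢g = two-boundary-vertices c₀∉F
           n , p = Enter-≈ (enter (≈-∉F c₀∉F c≈u) (~-sym u~f)) (≈-sym c≈u ◅◅ c≈u′)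
       in suc n , f , g , f∈F , g∈F , f≢g , u′ , n , p , u′~g , refl)

  private
    l : ℕ
    l = proj₁ shortest-crossing

    l-min : ∀ {n} → Crossing n → l ≤ n
    l-min = proj₂ (proj₂ shortest-crossing)

    -- The endpoints have different preimages under ψ, so the contracted walk has at least one step,
    -- and each of its steps accounts for `l` steps of `w`.
    far : ∀ {f g} → F f → F g → f ≢ g → (w : Star _~_ f g) → l ≤ steps w
    far f∈F g∈F f≢g w with x , refl ← F⇒ψ f∈F | y , refl ← F⇒ψ g∈F with contract l-min refl refl w
    ... | ε     , _  = contradiction refl f≢g
    ... | e ◅ p , le = ℕ.≤-trans (ℕ.m≤m+n l (steps p * l)) le

    -- Isomorphisms carry a shortest crossing into every cell, and no walk
    -- between different vertices of F is shorter, so that by H2 all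
    -- distances within the boundary of a cell are equal to l.
    θ-distance-l : ∀ {c f g} → ¬ F c → θ c f → θ c g → f ≢ g → IsDistance X f g l
    θ-distance-l {c} {f} {g} c∉F f∈ g∈ f≢g = compare (proj₁ (proj₂ shortest-crossing))
      where
      compare : Crossing l → IsDistance X f g l
      compare (f₁ , g₁ , f₁∈F , g₁∈F , f₁≢g₁ , u , m , p , u~g₁ , l≡) =
        subst (IsDistance X f g) (H2 (cell-isCell c∉F)
          (θ⇒boundary c∉F f∈) (θ⇒boundary c∉F g∈)
          (θ⇒boundary c∉F (α-θ f₁∈θ)) (θ⇒boundary c∉F (α-θ g₁∈θ))
          f≢g αf₁≢αg₁ (proj₂ (distance f g)) (path , far (αθ⊆F f₁∈θ) (αθ⊆F g₁∈θ) αf₁≢αg₁))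
          (proj₂ (distance f g))
        where
        open CellIso (cellIso (Enter-∉F p) c∉F)
        f₁∈θ : θ u f₁
        f₁∈θ = Enter-θ f₁∈F p
        g₁∈θ : θ u g₁
        g₁∈θ = g₁∈F , u , ε , u~g₁
        αθ⊆F : ∀ {h} → θ u h → F (α h)
        αθ⊆F h∈ = proj₁ (α-θ h∈)
        αf₁≢αg₁ : α f₁ ≢ α g₁
        αf₁≢αg₁ eq = f₁≢g₁ (α-inj (inj₂ f₁∈θ) (inj₂ g₁∈θ) eq)
        path : ∃ λ (w : Star _~_ (α f₁) (α g₁)) → steps w ≡ l
        path with w , eq ← α-Enter (cellIso (Enter-∉F p) c∉F) f₁∈θ ε p =
          w ◅◅ (α-~ (inj₁ ε) (inj₂ g₁∈θ) u~g₁ ◅ ε) ,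
          trans (steps-snoc w _) (trans (cong suc eq) (sym l≡))

    l≡ν : l ≡ ν
    l≡ν with v , w , v∈ , w∈ , v≢w , d ← base-boundary =
      H2 (cell-isCell c₀∉F) v∈′ w∈′ v∈′ w∈′ v≢w v≢w (θ-distance-l c₀∉F v∈ w∈ v≢w) d
      where
      v∈′ = θ⇒boundary c₀∉F v∈
      w∈′ = θ⇒boundary c₀∉F w∈

  ψ-contract : ∀ {n x y} → Within n (ψ x) (ψ y) → ∃ λ m → Within m x y × m * ν ≤ n
  ψ-contract (w , w≤n) = let w′ , le = contract l-min refl refl w in
    steps w′ , (w′ , ℕ.≤-refl) , ℕ.≤-trans (subst (λ l → steps w′ * l ≤ steps w) l≡ν le) w≤n

  -- Each edge is replaced by a shortest walk, of length ν, between two boundary vertices of a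
  -- common cell.
  ψ-expand : ∀ {n x y} → Within n x y → Within (n * ν) (ψ x) (ψ y)
  ψ-expand (w , w≤n) = Within-mono (ℕ.*-monoˡ-≤ ν w≤n) (expand w)
    where
    expand : ∀ {x y} (w : Star _~_ x y) → Within (steps w * ν) (ψ x) (ψ y)
    expand ε = ε , z≤n
    expand (e ◅ w) with ψx≢ψy , c , c∉F , x∈θ , y∈θ ← ~⇒θ-ψ e
                   with (p , p≡l) , _ ← θ-distance-l c∉F x∈θ y∈θ ψx≢ψy =
      Within-trans (p , ℕ.≤-reflexive (trans p≡l l≡ν)) (expand w)

  -- Cell closures as finite lists, and their common diameter bound

  neighbours : V → List V
  neighbours x = proj₁ (locallyFinite x)

  ∈-neighbours : ∀ {x y} → x ~ y → y ∈ neighbours x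
  ∈-neighbours {x} {y} = to (proj₂ (proj₂ (locallyFinite x)) y)

  -- Made total by the empty list on F, so that it can be applied throughout a list of vertices.
  closureList : V → List V
  closureList c with decide (F c)
  ... | yes _   = []
  ... | no c∉F = proj₁ (H1-finite (cell-isCell c∉F))

  ∈-closureList⁺ : ∀ {c x} → ¬ F c → Cl c x → x ∈ closureList c
  ∈-closureList⁺ {c} {x} c∉F x∈ with decide (F c)
  ... | yes c∈F  = contradiction c∈F c∉F
  ... | no c∉F′ = to (proj₂ (proj₂ (H1-finite (cell-isCell c∉F′))) x) (Cl⇒closure c∉F′ x∈)

  ∈-closureList⁻ : ∀ {c x} → x ∈ closureList c → ¬ F c × Cl c x
  ∈-closureList⁻ {c} {x} x∈ with decide (F c)
  ... | no c∉F = c∉F , closure⇒Cl c∉F (from (proj₂ (proj₂ (H1-finite (cell-isCell c∉F))) x) x∈)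

  length-closureList : ∀ c → length (closureList c) ≤ length (closureList c₀)
  length-closureList c with decide (F c)
  ... | yes _ = z≤n
  ... | no c∉F = length-mono {_≈_ = _≡_} (λ x x₀ → x ≡ α x₀) (λ p q → trans p (sym q)) (closureList c₀)
      (proj₁ (proj₂ (H1-finite (cell-isCell c∉F)))) λ x∈ →
        let x₀ , x₀∈ , eq = α-surj (closure⇒Cl c∉F (from (proj₂ (proj₂ (H1-finite (cell-isCell c∉F))) _) x∈))
        in x₀ , ∈-closureList⁺ c₀∉F x₀∈ , eq
    where open CellIso (chart c c∉F)

  private
    -- Since these walks stay inside the closure of `c₀`, the charts preserve their lengths, and the
    -- same δ serves every cell.
    base-diameter : ∃ λ δ → ∀ {xy} → xy ∈ cartesianProduct (closureList c₀) (closureList c₀) →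
      ∃ λ (w : Star (Step X (Cl c₀)) (proj₁ xy) (proj₂ xy)) → steps w ≤ δ
    base-diameter = bound (λ m≤n (w , w≤m) → w , ℕ.≤-trans w≤m m≤n) _ λ xy∈ →
      let x∈ , y∈ = ∈-cartesianProduct⁻ (closureList c₀) (closureList c₀) xy∈
          w = path (proj₂ (∈-closureList⁻ x∈)) (proj₂ (∈-closureList⁻ y∈))
      in steps w , w , ℕ.≤-refl
      where
      path : ∀ {x y} → Cl c₀ x → Cl c₀ y → Star (Step X (Cl c₀)) x y
      path x∈ y∈ = reverse (λ (x∈ , y∈ , x~y) → y∈ , x∈ , ~-sym x~y) (cell-path c₀∉F x∈) ◅◅ cell-path c₀∉F y∈

  δ : ℕ
  δ = proj₁ base-diameter

  cell-diameter : ∀ {c x y} → ¬ F c → Cl c x → Cl c y → Within δ x y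
  cell-diameter {c} c∉F x∈ y∈
    with x₀ , x₀∈ , refl ← CellIso.α-surj (chart c c∉F) x∈
       | y₀ , y₀∈ , refl ← CellIso.α-surj (chart c c∉F) y∈ =
    let w , w≤ = proj₂ base-diameter (∈-cartesianProduct⁺ (∈-closureList⁺ c₀∉F x₀∈) (∈-closureList⁺ c₀∉F y₀∈))
        w′ , eq = α-path (chart c c∉F) w
    in w′ , subst (_≤ δ) (sym eq) w≤

  -- Parents and children of cells

  Child : V → V → Set
  Child c a = ∃ λ v → θ c (ψ v) × a ≈ v × ¬ F v

  Child-∉F : ∀ {c a} → Child c a → ¬ F c
  Child-∉F (v , (_ , u , c≈u , u~ψv) , _) c∈F with c≈u
  ... | ε               = F1 c∈F (ψ∈F v) u~ψv
  ... | (c∉F , _) ◅ _ = c∉F c∈F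

  Child-resp : ∀ {c c′ a a′} → c ≈ c′ → a ≈ a′ → Child c a → Child c′ a′
  Child-resp c≈c′ a≈a′ (v , v∈θ , a≈v , v∉F) = v , θ-resp c≈c′ v∈θ , ≈-sym a≈a′ ◅◅ a≈v , v∉F

  -- Two different boundary vertices have adjacent preimages under ψ. By F1 one of these lies
  -- outside F, and its cell is a parent.
  parent : ∀ {c} → ¬ F c → ∃ λ a → ¬ F a × Child c a
  parent c∉F with f , g , f∈θ , g∈θ , f≢g ← two-boundary-vertices c∉F
             with x , refl ← F⇒ψ (proj₁ f∈θ) | y , refl ← F⇒ψ (proj₁ g∈θ)
             with decide (F x)
  ... | no x∉F  = x , x∉F , x , f∈θ , ε , x∉F
  ... | yes x∈F = y , y∉F , y , g∈θ , ε , y∉F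
    where
    y∉F : ¬ F y
    y∉F y∈F = F1 x∈F y∈F (θ-ψ⇒~ c∉F f∈θ g∈θ λ { refl → f≢g refl })

  -- The preimages of the boundary vertices of c form a clique containing a vertex `v` of the cell
  -- of a, so each of them is `v` or a neighbour of `v`.
  Child⇒Cl : ∀ {c a x} → Child c a → θ c (ψ x) → Cl a x
  Child⇒Cl {x = x} child@(v , v∈θ , a≈v , v∉F) x∈θ with decide (v ≡ x)
  ... | yes refl = inj₁ a≈v
  ... | no v≢x   = Cl-~ a≈v v∉F (θ-ψ⇒~ (Child-∉F child) v∈θ x∈θ v≢x)

  parent-unique : ∀ {c a a′} → Child c a → Child c a′ → a ≈ a′
  parent-unique child (v , v∈θ , a′≈v , v∉F) with Child⇒Cl child v∈θ
  ... | inj₁ a≈v       = a≈v ◅◅ ≈-sym a′≈v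
  ... | inj₂ (v∈F , _) = contradiction v∈F v∉F

  abstract
    children-finite : ∀ a → Finite cellSetoid (λ c → Child c a)
    children-finite a = enumerate cellSetoid (λ c → Child c a) (λ c≈c′ → Child-resp c≈c′ ε)
      -- Every child contains a neighbour of ψ v for some vertex v of the cell, so these finitely
      -- many neighbours represent all children.
      (concatMap (neighbours ∘ ψ) (closureList a))
      λ { (v , (_ , u , c≈u , u~ψv) , a≈v , v∉F) → Any.map (λ { refl → c≈u })
            (∈-concatMap (neighbours ∘ ψ)
              (∈-closureList⁺ (≈-∉F v∉F (≈-sym a≈v)) (inj₁ a≈v)) (∈-neighbours (~-sym u~ψv))) }

  children : V → List V
  children a = proj₁ (children-finite a)

  children-! : ∀ a → AllPairs (λ c d → ¬ c ≈ d) (children a)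
  children-! a = proj₁ (proj₂ (children-finite a))

  ∈-children⁻ : ∀ {a c} → c ∈ children a → Child c a
  ∈-children⁻ {a} {c} c∈ = from (proj₂ (proj₂ (children-finite a)) c) (Any.map (λ { refl → ε }) c∈)

  ∈-children⁺ : ∀ {a c} → Child c a → ∃ λ d → d ∈ children a × c ≈ d
  ∈-children⁺ {a} {c} child = find (to (proj₂ (proj₂ (children-finite a)) c) child)

  -- All cells have the same number of children

  BaseEdge BasePair : Pred (V × V) 0ℓ
  BaseEdge (x , y) = Cl c₀ x × Cl c₀ y × x ~ y
  BasePair (f , g) = θ c₀ f × θ c₀ g × f ≢ g

  abstract
    baseEdges-finite : Finite (setoid (V × V)) BaseEdge
    baseEdges-finite = enumerate (setoid (V × V)) BaseEdge (λ { refl → id })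
      (cartesianProduct (closureList c₀) (closureList c₀))
      λ (x∈ , y∈ , _) → ∈-cartesianProduct⁺ (∈-closureList⁺ c₀∉F x∈) (∈-closureList⁺ c₀∉F y∈)

    basePairs-finite : Finite (setoid (V × V)) BasePair
    basePairs-finite = enumerate (setoid (V × V)) BasePair (λ { refl → id })
      (cartesianProduct (closureList c₀) (closureList c₀))
      λ (f∈ , g∈ , _) → ∈-cartesianProduct⁺ (∈-closureList⁺ c₀∉F (inj₂ f∈)) (∈-closureList⁺ c₀∉F (inj₂ g∈))

  baseEdges basePairs : List (V × V)
  baseEdges = proj₁ baseEdges-finite
  basePairs = proj₁ basePairs-finite

  basePairs-nonEmpty : NonZero (length basePairs)
  basePairs-nonEmpty with f , g , f∈ , g∈ , f≢g ← two-boundary-vertices c₀∉F =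
    ∈⇒length≢0 (to (proj₂ (proj₂ basePairs-finite) (f , g)) (f∈ , g∈ , f≢g))

  -- Every ordered edge of the closure of a is mapped by ψ to a pair of
  -- distinct boundary vertices of exactly one child of a, so counting
  -- ordered edges counts children.
  module _ {a} (a∉F : ¬ F a) where
    private
      module A = CellIso (chart a a∉F)

      φ : ∀ c → .(¬ F c) → V → V
      φ c c∉F = CellIso.α (chart c c∉F)

      Match : V × (V × V) → V × V → Set
      Match (c , f , g) (x , y) = ∃ λ (c∉F : ¬ F c) → c ∈ children a ×
        BasePair (f , g) × BaseEdge (x , y) × ψ (A.α x) ≡ φ c c∉F f × ψ (A.α y) ≡ φ c c∉F g

      -- The images under ψ of the ends of an edge are two different boundary vertices, which by F2
      -- determine the child; its chart then determines the pair.
      Match-injˡ : ∀ {p q e} → Match p e → Match q e → p ≡ q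
      Match-injˡ {c , f , g} {d , f′ , g′} {x , y}
        (c∉F , c∈ , (f∈ , g∈ , _) , (x∈ , y∈ , x~y) , xf , yg)
        (d∉F , d∈ , (f′∈ , g′∈ , _) , _ , xf′ , yg′) = conclude
          (Unique-≈⇒≡ cellSetoid (children-! a) c∈ d∈ (shared-pair⇒≈ c∉F d∉F ψx≢ψy
            (subst (θ c) (sym xf) (CellIso.α-θ (chart c c∉F) f∈))
            (subst (θ c) (sym yg) (CellIso.α-θ (chart c c∉F) g∈))
            (subst (θ d) (sym xf′) (CellIso.α-θ (chart d d∉F) f′∈))
            (subst (θ d) (sym yg′) (CellIso.α-θ (chart d d∉F) g′∈))))
        where
        ψx≢ψy : ψ (A.α x) ≢ ψ (A.α y)
        ψx≢ψy eq = ~-irrefl (subst (A.α x ~_) (sym (ψ-inj eq)) (A.α-~ x∈ y∈ x~y))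
        conclude : c ≡ d → (c , f , g) ≡ (d , f′ , g′)
        conclude refl = cong₂ (λ f g → c , f , g)
          (CellIso.α-inj (chart c c∉F) (inj₂ f∈) (inj₂ f′∈) (trans (sym xf) xf′))
          (CellIso.α-inj (chart c c∉F) (inj₂ g∈) (inj₂ g′∈) (trans (sym yg) yg′))

      Match-injʳ : ∀ {p e e′} → Match p e → Match p e′ → e ≡ e′
      Match-injʳ (_ , _ , _ , (x∈ , y∈ , _) , xf , yg) (_ , _ , _ , (x′∈ , y′∈ , _) , x′f , y′g) =
        cong₂ _,_ (A.α-inj x∈ x′∈ (ψ-inj (trans xf (sym x′f))))
                  (A.α-inj y∈ y′∈ (ψ-inj (trans yg (sym y′g))))

      matchʳ : ∀ {p} → p ∈ cartesianProduct (children a) basePairs → ∃ λ e → e ∈ baseEdges × Match p e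
      matchʳ {c , f , g} p∈
        with c∈ , fg∈ ← ∈-cartesianProduct⁻ (children a) basePairs p∈
        with pair@(f∈ , g∈ , f≢g) ← from (proj₂ (proj₂ basePairs-finite) (f , g)) fg∈ =
          build (F⇒ψ (proj₁ φf∈)) (F⇒ψ (proj₁ φg∈))
        where
        child : Child c a
        child = ∈-children⁻ c∈
        c∉F : ¬ F c
        c∉F = Child-∉F child
        φf∈ : θ c (φ c c∉F f)
        φf∈ = CellIso.α-θ (chart c c∉F) f∈
        φg∈ : θ c (φ c c∉F g)
        φg∈ = CellIso.α-θ (chart c c∉F) g∈
        build : (∃ λ x → φ c c∉F f ≡ ψ x) → (∃ λ y → φ c c∉F g ≡ ψ y) → ∃ λ e → e ∈ baseEdges × Match (c , f , g) e
        build (x′ , fx) (y′ , gy)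
          with x , x∈ , refl ← A.α-surj (Child⇒Cl child (subst (θ c) fx φf∈))
             | y , y∈ , refl ← A.α-surj (Child⇒Cl child (subst (θ c) gy φg∈)) =
            (x , y) , to (proj₂ (proj₂ baseEdges-finite) (x , y)) edge ,
            c∉F , c∈ , pair , edge , sym fx , sym gy
          where
          x≢y : A.α x ≢ A.α y
          x≢y eq = f≢g (CellIso.α-inj (chart c c∉F) (inj₂ f∈) (inj₂ g∈) (trans fx (trans (cong ψ eq) (sym gy))))
          edge : BaseEdge (x , y)
          edge = x∈ , y∈ , A.α-~⁻ x∈ y∈
            (θ-ψ⇒~ c∉F (subst (θ c) fx φf∈) (subst (θ c) gy φg∈) x≢y)

      -- By F1 one end of the edge lies in the cell of a itself and not only on its boundary.
      edge-child : ∀ {c x y} → ¬ F c → Cl a x → Cl a y → x ~ y → θ c (ψ x) → θ c (ψ y) → Child c a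
      edge-child c∉F (inj₁ a≈x) _ _ x∈θ _ = _ , x∈θ , a≈x , ≈-∉F a∉F a≈x
      edge-child c∉F (inj₂ _) (inj₁ a≈y) _ _ y∈θ = _ , y∈θ , a≈y , ≈-∉F a∉F a≈y
      edge-child c∉F (inj₂ (x∈F , _)) (inj₂ (y∈F , _)) x~y _ _ = contradiction x~y (F1 x∈F y∈F)

      matchˡ : ∀ {e} → e ∈ baseEdges → ∃ λ p → p ∈ cartesianProduct (children a) basePairs × Match p e
      matchˡ {x , y} e∈
        with edge@(x∈ , y∈ , x~y) ← from (proj₂ (proj₂ baseEdges-finite) (x , y)) e∈
        with ψx≢ψy , c′ , c′∉F , x∈θ′ , y∈θ′ ← ~⇒θ-ψ (A.α-~ x∈ y∈ x~y)
        with c , c∈ , c′≈c ← ∈-children⁺ (edge-child c′∉F (A.α-Cl x∈) (A.α-Cl y∈) (A.α-~ x∈ y∈ x~y) x∈θ′ y∈θ′) =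
          build (CellIso.α-surjθ (chart c c∉F) (θ-resp c′≈c x∈θ′)) (CellIso.α-surjθ (chart c c∉F) (θ-resp c′≈c y∈θ′))
        where
        c∉F : ¬ F c
        c∉F = Child-∉F (∈-children⁻ c∈)
        build : (∃ λ f → θ c₀ f × ψ (A.α x) ≡ φ c c∉F f) → (∃ λ g → θ c₀ g × ψ (A.α y) ≡ φ c c∉F g) →
                ∃ λ p → p ∈ cartesianProduct (children a) basePairs × Match p (x , y)
        build (f , f∈ , xf) (g , g∈ , yg) =
          (c , f , g) , ∈-cartesianProduct⁺ c∈ (to (proj₂ (proj₂ basePairs-finite) (f , g)) pair) ,
          c∉F , c∈ , pair , edge , xf , yg
          where
          pair : BasePair (f , g)
          pair = f∈ , g∈ , λ { refl → ψx≢ψy (trans xf (sym yg)) }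

    children-count : length (children a) * length basePairs ≡ length baseEdges
    children-count = trans (sym (length-cartesianProduct (children a) basePairs)) (ℕ.≤-antisym
      (length-mono {_≈_ = _≡_} Match Match-injˡ baseEdges
        (Unique-≡.cartesianProduct⁺ (AllPairs.map (λ { c≉d refl → c≉d ε }) (children-! a)) (proj₁ (proj₂ basePairs-finite)))
        matchʳ)
      (length-mono {_≈_ = _≡_} (flip Match) Match-injʳ (cartesianProduct (children a) basePairs)
        (proj₁ (proj₂ baseEdges-finite)) matchˡ))

  -- Cells inside a 2-cell

  F⇒F¹ : ∀ {x} → F x → iteratedImage X ψ 1 x
  F⇒F¹ x∈F = let y , eq = F⇒ψ x∈F in y , _ , eq

  ψ∈F²⇒∈F : ∀ {v} → iteratedImage X ψ 2 (ψ v) → F v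
  ψ∈F²⇒∈F (w , (z , _ , refl) , eq) = subst F (sym (ψ-inj eq)) (ψ∈F z)

  F²⊆F : ∀ {x} → iteratedImage X ψ 2 x → F x
  F²⊆F (w , _ , refl) = ψ∈F w

  infix 4 _≈₂_
  _≈₂_ : V → V → Set
  _≈₂_ = Star (Step X (∁ (iteratedImage X ψ 2)))

  ≈⇒≈₂ : ∀ {x y} → x ≈ y → x ≈₂ y
  ≈⇒≈₂ ε                         = ε
  ≈⇒≈₂ ((x∉F , y∉F , x~y) ◅ p) = (x∉F ∘ F²⊆F , y∉F ∘ F²⊆F , x~y) ◅ ≈⇒≈₂ p

  ≈₂-sym : ∀ {x y} → x ≈₂ y → y ≈₂ x
  ≈₂-sym = reverse λ (x∉ , y∉ , x~y) → y∉ , x∉ , ~-sym x~y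

  θ⇒≈₂ : ∀ {c v} → ¬ F c → ¬ F v → θ c (ψ v) → c ≈₂ ψ v
  θ⇒≈₂ c∉F v∉F (_ , u , c≈u , u~ψv) =
    ≈⇒≈₂ c≈u ◅◅ ((≈-∉F c∉F c≈u ∘ F²⊆F , v∉F ∘ ψ∈F²⇒∈F , u~ψv) ◅ ε)

  -- For an edge between v and w outside F, the vertices ψ v and ψ w bound a common cell and avoid
  -- the image of ψ², so they are joined through that cell.
  ψ-≈₂ : ∀ {v w} → v ≈ w → ψ v ≈₂ ψ w
  ψ-≈₂ ε = ε
  ψ-≈₂ ((v∉F , w∉F , v~w) ◅ p) with _ , c , c∉F , v∈θ , w∈θ ← ~⇒θ-ψ v~w =
    (≈₂-sym (θ⇒≈₂ c∉F v∉F v∈θ) ◅◅ θ⇒≈₂ c∉F w∉F w∈θ) ◅◅ ψ-≈₂ p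

  Child⇒≈₂ : ∀ {c v} → Child c v → ψ v ≈₂ c
  Child⇒≈₂ child@(w , w∈θ , v≈w , w∉F) =
    ψ-≈₂ v≈w ◅◅ ≈₂-sym (θ⇒≈₂ (Child-∉F child) w∉F w∈θ)

  -- Along a walk that avoids the image of ψ², every vertex is either ψ w with w in the cell of v,
  -- or lies in a child of v. Such a walk could leave this set only through some ψ w with w ∈ F,
  -- which is a vertex of the image of ψ².
  ≈₂⇒Child : ∀ {c v} → ¬ F v → ¬ F c → ψ v ≈₂ c → Child c v
  ≈₂⇒Child {c} {v} v∉F c∉F p = [ (λ (w , eq , _) → contradiction (subst F (sym eq) (ψ∈F w)) c∉F) , id ]′
    (follow p (inj₁ (v , refl , ε)))
    where
    Reached : V → Set
    Reached y = (∃ λ w → y ≡ ψ w × v ≈ w) ⊎ Child y v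
    advance : ∀ {y y′} → ¬ iteratedImage X ψ 2 y′ → y ~ y′ → Reached y → Reached y′
    advance {y′ = y′} y′∉ y~y′ r with decide (F y′)
    advance y′∉ y~y′ (inj₁ (w , refl , v≈w)) | yes y′∈F = contradiction y~y′ (F1 (ψ∈F w) y′∈F)
    advance y′∉ y~y′ (inj₁ (w , refl , v≈w)) | no y′∉F  =
      inj₂ (w , (ψ∈F w , _ , ε , ~-sym y~y′) , v≈w , ≈-∉F v∉F v≈w)
    advance y′∉ y~y′ (inj₂ child) | no y′∉F  = inj₂ (Child-resp (~⇒≈ (Child-∉F child) y′∉F y~y′) ε child)
    advance y′∉ y~y′ (inj₂ child) | yes y′∈F with w , refl ← F⇒ψ y′∈F
      with Child⇒Cl child (y′∈F , _ , ε , y~y′)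
    ... | inj₁ v≈w       = inj₁ (w , refl , v≈w)
    ... | inj₂ (w∈F , _) = contradiction (w , F⇒F¹ w∈F , refl) y′∉
    follow : ∀ {y z} → y ≈₂ z → Reached y → Reached z
    follow ε                          r = r
    follow ((_ , y′∉ , y~y′) ◅ p) r = follow p (advance y′∉ y~y′ r)

  module _ {μ : ℕ} (volume-scaling : IsVolumeScalingFactor X F ψ μ) where

    -- A 2-cell contains some ψ v with v ∉ F, and the cells inside it are
    -- the children of v.
    private
      2-cell-children : ∃ λ v → ¬ F v × length (children v) ≡ μ
      2-cell-children = count volume-scaling
        where
        special : ∀ {d} → ¬ iteratedImage X ψ 2 d → ∃ λ v → ¬ F v × d ≈₂ ψ v
        special {d} d∉ with decide (F d)
        ... | yes d∈F with v , refl ← F⇒ψ d∈F = v , (λ v∈F → d∉ (v , F⇒F¹ v∈F , refl)) , ε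
        special {d} d∉ | no d∉F with a , a∉F , v , v∈θ , _ , v∉F ← parent d∉F =
          v , v∉F , θ⇒≈₂ d∉F v∉F v∈θ
        count : IsVolumeScalingFactor X F ψ μ → ∃ λ v → ¬ F v × length (children v) ≡ μ
        count (D , (d , d∉ , D⊆ , ⊆D) , Cs , (Cs! , Cs⇔) , refl) with v , v∉F , d≈₂ψv ← special d∉ =
          v , v∉F , ℕ.≤-antisym
            (length-mono {_≈_ = _≈_} (λ c C → C ≐ cell c)
              (λ (_ , c⊆C) (C⊆d , _) → ≈-sym (C⊆d (c⊆C ε))) Cs (children-! v) λ c∈ →
                let C , C∈ , c≐C = find (to (Cs⇔ _) (child-cell (∈-children⁻ c∈)))
                in C , C∈ , ≐-sym c≐C)
            (length-mono {_≈_ = _≐_} (λ C c → C ≐ cell c)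
              (λ C≐c D≐c → ≐-trans C≐c (≐-sym D≐c)) (children v) Cs! λ {C} C∈ →
                let (c , c∉F , C≐c) , C⊆D = from (Cs⇔ C) (Any.map (λ { refl → ≐-refl }) C∈)
                    c′ , c′∈ , c≈c′ = ∈-children⁺ (≈₂⇒Child v∉F c∉F (≈₂-sym d≈₂ψv ◅◅ D⊆ (C⊆D (proj₂ C≐c ε))))
                in c′ , c′∈ , ≐-trans C≐c ((≈-sym c≈c′ ◅◅_) , (c≈c′ ◅◅_)))
          where
          open Setoid (≐-setoid V 0ℓ) using () renaming (refl to ≐-refl; sym to ≐-sym; trans to ≐-trans)
          child-cell : ∀ {c} → Child c v → IsCell X F (cell c) × cell c ⊆ D
          child-cell child = cell-isCell (Child-∉F child) ,
            λ c≈x → ⊆D ((d≈₂ψv ◅◅ Child⇒≈₂ child) ◅◅ ≈⇒≈₂ c≈x)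

    -- The number of children times the number of boundary pairs equals the number of edges in `c₀`,
    -- the same product for every cell; the positive number of boundary pairs cancels.
    length-children : ∀ {a} → ¬ F a → length (children a) ≡ μ
    length-children a∉F with v , v∉F , refl ← 2-cell-children =
      ℕ.*-cancelʳ-≡ _ _ (length basePairs) {{basePairs-nonEmpty}}
        (trans (children-count a∉F) (sym (children-count v∉F)))

  -- Ancestors and descendants

  iterate-ψ : ℕ → V → V
  iterate-ψ zero    a = a
  iterate-ψ (suc n) a = ψ (iterate-ψ n a)

  Descendant : ℕ → V → V → Set
  Descendant zero    c a = c ≡ a
  Descendant (suc n) c a = ∃ λ b → Child c b × Descendant n b a

  Child-near : ∀ {c a} → Child c a → Within (δ + δ * ν) c (ψ a)
  Child-near child@(v , v∈θ , a≈v , v∉F) = Within-trans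
    (cell-diameter (Child-∉F child) (inj₁ ε) (inj₂ v∈θ))
    (ψ-expand (cell-diameter v∉F (inj₁ ε) (inj₁ (≈-sym a≈v))))

  -- The constant 3 works because the recursion k ↦ δ + δν + kν for the
  -- radius has its fixed point in [-3δ, 0] as soon as ν ≥ 2.
  Descendant-near′ : ∀ n {c a} → Descendant n c a →
    ∃ λ k → Within k c (iterate-ψ n a) × k + 3 * δ ≤ 3 * δ * ν ^ n
  Descendant-near′ zero    refl = 0 , (ε , z≤n) , ℕ.≤-reflexive (sym (ℕ.*-identityʳ (3 * δ)))
  Descendant-near′ (suc n) (b , child , desc) with k , near , le ← Descendant-near′ n desc =
    δ + δ * ν + k * ν , Within-trans (Child-near child) (ψ-expand near) , (begin
      δ + δ * ν + k * ν + 3 * δ      ≡⟨ rearrange₁ δ (δ * ν) (k * ν) ⟩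
      2 * δ * 2 + δ * ν + k * ν      ≤⟨ ℕ.+-monoˡ-≤ (k * ν) (ℕ.+-monoˡ-≤ (δ * ν) (ℕ.*-monoʳ-≤ (2 * δ) (nonTrivial⇒n>1 ν))) ⟩
      2 * δ * ν + δ * ν + k * ν      ≡⟨ rearrange₂ δ k ν ⟩
      (k + 3 * δ) * ν                ≤⟨ ℕ.*-monoˡ-≤ ν le ⟩
      3 * δ * ν ^ n * ν              ≡⟨ rearrange₃ (3 * δ) (ν ^ n) ν ⟩
      3 * δ * (ν * ν ^ n)            ∎)
    where
    rearrange₁ : ∀ a b c → a + b + c + 3 * a ≡ 2 * a * 2 + b + c
    rearrange₁ = solve-∀
    rearrange₂ : ∀ a k n → 2 * a * n + a * n + k * n ≡ (k + 3 * a) * n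
    rearrange₂ = solve-∀
    rearrange₃ : ∀ a b c → a * b * c ≡ a * (c * b)
    rearrange₃ = solve-∀

  Descendant-near : ∀ n {c a} → Descendant n c a → Within (3 * δ * ν ^ n) c (iterate-ψ n a)
  Descendant-near n desc with k , near , le ← Descendant-near′ n desc =
    Within-mono (ℕ.≤-trans (ℕ.m≤m+n k (3 * δ)) le) near

  iterate-ψ-contract : ∀ n {k a b} → Within k (iterate-ψ n a) (iterate-ψ n b) →
    ∃ λ m → Within m a b × m * ν ^ n ≤ k
  iterate-ψ-contract zero    {k} w = k , w , ℕ.≤-reflexive (ℕ.*-identityʳ k)
  iterate-ψ-contract (suc n) {k} w with k′ , w′ , le′ ← ψ-contract w
                                   with m , w″ , le ← iterate-ψ-contract n w′ = m , w″ , (begin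
    m * (ν * ν ^ n)   ≡⟨ cong (m *_) (ℕ.*-comm ν (ν ^ n)) ⟩
    m * (ν ^ n * ν)   ≡⟨ ℕ.*-assoc m (ν ^ n) ν ⟨
    m * ν ^ n * ν     ≤⟨ ℕ.*-monoˡ-≤ ν le ⟩
    k′ * ν            ≤⟨ le′ ⟩
    k                 ∎)

  ancestor : ∀ n {c} → ¬ F c → ∃ λ a → ¬ F a × Descendant n c a
  ancestor zero    c∉F = _ , c∉F , refl
  ancestor (suc n) c∉F with b , b∉F , child ← parent c∉F with a , a∉F , desc ← ancestor n b∉F =
    a , a∉F , b , child , desc

  descendants : ℕ → V → List V
  descendants zero    a = [ a ]
  descendants (suc n) a = concatMap children (descendants n a)

  ∈-descendants⁻ : ∀ n {a c} → c ∈ descendants n a → Descendant n c a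
  ∈-descendants⁻ zero    (here c≡a) = c≡a
  ∈-descendants⁻ (suc n) {a} c∈ with b , b∈ , c∈b ← ∈-concatMap-∃ children {xs = descendants n a} c∈ =
    b , ∈-children⁻ c∈b , ∈-descendants⁻ n b∈

  ∈-descendants⁺ : ∀ n {a c} → Descendant n c a → ∃ λ d → d ∈ descendants n a × c ≈ d
  ∈-descendants⁺ zero    refl = _ , here refl , ε
  ∈-descendants⁺ (suc n) (b , child , desc)
    with b′ , b′∈ , b≈b′ ← ∈-descendants⁺ n desc
    with d , d∈ , c≈d ← ∈-children⁺ (Child-resp ε b≈b′ child) =
    d , ∈-concatMap children b′∈ d∈ , c≈d

  -- Inequivalent cells share no child by `parent-unique`, so no cell is listed twice.
  descendants-! : ∀ n a → AllPairs (λ c d → ¬ c ≈ d) (descendants n a)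
  descendants-! zero    a = All.[] ∷ []
  descendants-! (suc n) a = concatMap-! cellSetoid children-!
    (λ u∈ v∈ u≈v → parent-unique (∈-children⁻ u∈) (Child-resp (≈-sym u≈v) ε (∈-children⁻ v∈)))
    (descendants-! n a)

  Descendant-∉F : ∀ n {c a} → ¬ F a → Descendant n c a → ¬ F c
  Descendant-∉F zero    a∉F refl = a∉F
  Descendant-∉F (suc n) a∉F (b , child , _) = Child-∉F child

  -- Finiteness of balls

  first-step : ∀ {x y} → Star _~_ x y → x ≢ y → ∃ (x ~_)
  first-step ε       x≢x = contradiction refl x≢x
  first-step (e ◅ _) _   = _ , e

  neighbour : ∀ x → ∃ (x ~_)
  neighbour x with f , g , _ , _ , f≢g ← two-boundary-vertices c₀∉F with decide (x ≡ f)
  ... | yes refl = first-step (connected f g) f≢g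
  ... | no x≢f   = first-step (connected x f) x≢f

  deg≥1 : ∀ x → 1 ≤ deg x
  deg≥1 x = >-nonZero⁻¹ (deg x) {{∈⇒length≢0 (∈-neighbours (proj₂ (neighbour x)))}}

  near-cell : ∀ x → ∃ λ c → ¬ F c × Cl c x × Within 1 c x
  near-cell x with decide (F x)
  ... | no x∉F  = x , x∉F , inj₁ ε , (ε , z≤n)
  ... | yes x∈F = let u , x~u = neighbour x in
    u , (λ u∈F → F1 x∈F u∈F x~u) , inj₂ (x∈F , u , ε , ~-sym x~u) , ~⇒Within (~-sym x~u)

  -- A list of the endpoints of walks of length at most r, with repetitions; it serves as a finite
  -- cover of the ball.
  ballList : V → ℕ → List V
  ballList x zero    = [ x ]
  ballList x (suc r) = x ∷ concatMap (λ y → ballList y r) (neighbours x)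

  ∈-ballList : ∀ {x y} r → Within r x y → y ∈ ballList x r
  ∈-ballList zero    (ε , _)             = here refl
  ∈-ballList (suc r) (ε , _)             = here refl
  ∈-ballList (suc r) ((e ◅ w) , s≤s w≤r) =
    there (∈-concatMap (λ y → ballList y r) (∈-neighbours e) (∈-ballList r (w , w≤r)))

  ball-volume : ∀ x r → ∃ (HasVolume X (Ball X x r))
  ball-volume x r =
    let ys , ys! , ys⇔ = enumerate (setoid V) (Ball X x r) (λ { refl → id }) (ballList x r)
          λ y∈ → ∈-ballList r (Within-sym (Ball⇒Within y∈))
    in _ , ys , (ys! , ys⇔) , refl

  -- Volume bounds for balls and the growth dimensions

  module _ {μ : ℕ} (volume-scaling : IsVolumeScalingFactor X F ψ μ) {b : ℕ} (deg≤b : ∀ x → deg x ≤ b) where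

    length-children-≤ : ∀ a → length (children a) ≤ μ
    length-children-≤ a with decide (F a)
    ... | no a∉F  = ℕ.≤-reflexive (length-children volume-scaling a∉F)
    ... | yes a∈F = none (children a) λ c∈ → let v , _ , a≈v , v∉F = ∈-children⁻ c∈ in ≈-∉F v∉F (≈-sym a≈v) a∈F
      where
      none : ∀ xs → (∀ {c} → ¬ c ∈ xs) → length xs ≤ μ
      none []      _   = z≤n
      none (_ ∷ _) c∉ = contradiction (here refl) c∉

    length-descendants-≤ : ∀ n a → length (descendants n a) ≤ μ ^ n
    length-descendants-≤ zero    a = ℕ.≤-refl
    length-descendants-≤ (suc n) a = ℕ.≤-trans
      (length-concatMap-≤ children length-children-≤ (descendants n a))
      (ℕ.≤-trans (ℕ.*-monoˡ-≤ μ (length-descendants-≤ n a)) (ℕ.≤-reflexive (ℕ.*-comm (μ ^ n) μ)))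

    length-descendants-≥ : ∀ n {a} → ¬ F a → μ ^ n ≤ length (descendants n a)
    length-descendants-≥ zero    a∉F = ℕ.≤-refl
    length-descendants-≥ (suc n) {a} a∉F = ℕ.≤-trans
      (ℕ.≤-trans (ℕ.≤-reflexive (ℕ.*-comm μ (μ ^ n))) (ℕ.*-monoˡ-≤ μ (length-descendants-≥ n a∉F)))
      (length-concatMap-≥ children (descendants n a) λ c∈ →
        ℕ.≤-reflexive (sym (length-children volume-scaling (Descendant-∉F n a∉F (∈-descendants⁻ n c∈)))))

    ballSize : ℕ → ℕ
    ballSize zero    = 1
    ballSize (suc r) = suc (b * ballSize r)

    length-ballList : ∀ x r → length (ballList x r) ≤ ballSize r
    length-ballList x zero    = ℕ.≤-refl
    length-ballList x (suc r) = s≤s (ℕ.≤-trans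
      (length-concatMap-≤ (λ y → ballList y r) (λ y → length-ballList y r) (neighbours x))
      (ℕ.*-monoˡ-≤ (ballSize r) (deg≤b x)))

    -- A cell near x and all descendants of its n-th ancestor a lie within 3δνⁿ of ψⁿ(a). One more
    -- step leads to x, and 6δνⁿ + 1 ≤ (6δ + 1)νⁿ. Inequivalent descendants are different vertices,
    -- each of degree at least 1.
    volume-lower : ∀ {n r x v} → suc (6 * δ) * ν ^ n ≤ r → HasVolume X (Ball X x r) v → μ ^ n ≤ v
    volume-lower {n} {r} {x} Kνⁿ≤r (ys , (ys! , ys⇔) , refl)
      with c , c∉F , _ , c-near ← near-cell x
      with a , a∉F , desc ← ancestor n c∉F = begin
        μ ^ n                       ≤⟨ length-descendants-≥ n a∉F ⟩
        length (descendants n a)    ≤⟨ length-⊆ (AllPairs.map (λ { c≉d refl → c≉d ε }) (descendants-! n a))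
                                         (λ d∈ → to (ys⇔ _) (Within⇒Ball (near (∈-descendants⁻ n d∈)))) ⟩
        length ys                   ≤⟨ sum-map-≥ deg deg≥1 ys ⟩
        sum (map deg ys)            ∎
      where
      rearrange : ∀ a x → 3 * a * x + 3 * a * x ≡ 6 * a * x
      rearrange = solve-∀
      radius : 3 * δ * ν ^ n + (3 * δ * ν ^ n + 1) ≤ r
      radius = begin
        3 * δ * ν ^ n + (3 * δ * ν ^ n + 1)   ≡⟨ ℕ.+-assoc (3 * δ * ν ^ n) _ 1 ⟨
        3 * δ * ν ^ n + 3 * δ * ν ^ n + 1     ≡⟨ cong (_+ 1) (rearrange δ (ν ^ n)) ⟩
        6 * δ * ν ^ n + 1                     ≤⟨ ℕ.+-monoʳ-≤ (6 * δ * ν ^ n) (ℕ.m^n>0 ν {{nonTrivial⇒nonZero ν}} n) ⟩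
        6 * δ * ν ^ n + ν ^ n                 ≡⟨ ℕ.+-comm (6 * δ * ν ^ n) (ν ^ n) ⟩
        suc (6 * δ) * ν ^ n                   ≤⟨ Kνⁿ≤r ⟩
        r                                     ∎
      near : ∀ {d} → Descendant n d a → Within r d x
      near desc′ = Within-mono radius (Within-trans (Descendant-near n desc′)
        (Within-trans (Within-sym (Descendant-near n desc)) c-near))

    private
      R L : ℕ
      -- In units of νⁿ: 3δ from each of two cells to the image of its ancestor, 1 for the radius,
      -- and 2 for the steps from x and y to nearby cells.
      R = 6 * δ + 3
      -- The factors bound the number of ancestors, the number of vertices in the closure of a
      -- descendant, and the degrees.
      L = ballSize R * length (closureList c₀) * b

    -- For y in the ball, the n-th ancestors a and a′ of cells near x and y have images under ψⁿ at
    -- distance at most Rνⁿ. Contraction by ψⁿ puts a′ within R of a, which leaves boundedly many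
    -- a′, independently of n and x.
    volume-upper : ∀ {n r x v} → r ≤ ν ^ n → HasVolume X (Ball X x r) v → v ≤ L * μ ^ n
    volume-upper {n} {r} {x} r≤νⁿ (ys , (ys! , ys⇔) , refl)
      with c , c∉F , _ , c-near ← near-cell x
      with a , a∉F , desc ← ancestor n c∉F = begin
        sum (map deg ys)        ≤⟨ sum-map-≤ deg deg≤b ys ⟩
        length ys * b           ≤⟨ ℕ.*-monoˡ-≤ b (length-⊆ ys! λ y∈ → covered (Ball⇒Within (from (ys⇔ _) y∈))) ⟩
        length cover * b        ≤⟨ ℕ.*-monoˡ-≤ b (length-concatMap-≤ _ (λ a′ →
                                     ℕ.≤-trans (length-concatMap-≤ closureList length-closureList (descendants n a′))
                                       (ℕ.*-monoˡ-≤ m (length-descendants-≤ n a′))) (ballList a R)) ⟩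
        length (ballList a R) * (μ ^ n * m) * b
                                ≤⟨ ℕ.*-monoˡ-≤ b (ℕ.*-monoˡ-≤ (μ ^ n * m) (length-ballList a R)) ⟩
        ballSize R * (μ ^ n * m) * b  ≡⟨ rearrange₁ (ballSize R) (μ ^ n) m b ⟩
        L * μ ^ n               ∎
      where
      m : ℕ
      m = length (closureList c₀)
      rearrange₁ : ∀ s p m b → s * (p * m) * b ≡ s * m * b * p
      rearrange₁ = solve-∀
      rearrange₂ : ∀ a x → 3 * a * x + (1 + (x + (1 + 3 * a * x))) ≡ (6 * a + 1) * x + 2
      rearrange₂ = solve-∀
      rearrange₃ : ∀ a x → (6 * a + 1) * x + 2 * x ≡ (6 * a + 3) * x
      rearrange₃ = solve-∀
      cover : List V
      cover = concatMap (λ a′ → concatMap closureList (descendants n a′)) (ballList a R)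
      covered : ∀ {y} → Within r y x → y ∈ cover
      covered {y} y-near
        with d , d∉F , y∈Cl , d-near ← near-cell y
        with a′ , a′∉F , desc′ ← ancestor n d∉F
        with e , e∈ , d≈e ← ∈-descendants⁺ n desc′
        with k , a-a′ , kνⁿ≤ ← iterate-ψ-contract n
          (Within-trans (Within-sym (Descendant-near n desc)) (Within-trans c-near
            (Within-trans (Within-mono r≤νⁿ (Within-sym y-near))
              (Within-trans (Within-sym d-near) (Descendant-near n desc′))))) =
        ∈-concatMap (λ a′ → concatMap closureList (descendants n a′))
          (∈-ballList R (Within-mono (ℕ.*-cancelʳ-≤ k R (ν ^ n) {{νⁿ≢0}} (begin
            k * ν ^ n                       ≤⟨ kνⁿ≤ ⟩
            3 * δ * ν ^ n + (1 + (ν ^ n + (1 + 3 * δ * ν ^ n)))  ≡⟨ rearrange₂ δ (ν ^ n) ⟩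
            (6 * δ + 1) * ν ^ n + 2         ≤⟨ ℕ.+-monoʳ-≤ ((6 * δ + 1) * ν ^ n) (ℕ.*-monoʳ-≤ 2 (ℕ.m^n>0 ν {{nonTrivial⇒nonZero ν}} n)) ⟩
            (6 * δ + 1) * ν ^ n + 2 * ν ^ n ≡⟨ rearrange₃ δ (ν ^ n) ⟩
            R * ν ^ n                       ∎)) a-a′))
          (∈-concatMap closureList e∈ (∈-closureList⁺ (≈-∉F d∉F d≈e) (Cl-resp d≈e y∈Cl)))
        where
        νⁿ≢0 : NonZero (ν ^ n)
        νⁿ≢0 = ℕ.m^n≢0 ν n {{nonTrivial⇒nonZero ν}}
        Cl-resp : ∀ {c d y} → c ≈ d → Cl c y → Cl d y
        Cl-resp c≈d (inj₁ c≈y) = inj₁ (≈-sym c≈d ◅◅ c≈y)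
        Cl-resp c≈d (inj₂ y∈θ) = inj₂ (θ-resp c≈d y∈θ)

    -- The extremal volumes are attained by actual balls, so both extremal functions inherit the
    -- bounds that hold for every ball.
    growth-dimension : IsLowerGlobalGrowthDimension X (log μ / log ν) ×
                       IsUpperGlobalGrowthDimension X (log μ / log ν)
    growth-dimension =
      (V̲ , (λ r → proj₂ (proj₂ (V̲-inf r))) , proj₁ (PowerGrowth.growthExponent-limits ν μ V̲ (suc (6 * δ))
        (λ {n} {r} le → let x , vol = proj₁ (proj₂ (V̲-inf r)) in volume-lower {n} le vol) L
        (λ {n} {r} le → let x , vol = proj₁ (proj₂ (V̲-inf r)) in volume-upper {n} le vol))) ,
      (V̅ , (λ r → proj₂ (proj₂ (V̅-sup r))) , proj₂ (PowerGrowth.growthExponent-limits ν μ V̅ (suc (6 * δ))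
        (λ {n} {r} le → let x , vol = proj₁ (proj₂ (V̅-sup r)) in volume-lower {n} le vol) L
        (λ {n} {r} le → let x , vol = proj₁ (proj₂ (V̅-sup r)) in volume-upper {n} le vol)))
      where
      some : ∀ r → ∃ (BallVolume X r)
      some r = let v , vol = ball-volume c₀ r in v , c₀ , vol
      V̲-inf : ∀ r → ∃ λ v → BallVolume X r v × IsInf _≤_ (BallVolume X r) v
      V̲-inf r = infimum (BallVolume X r) (some r)
      V̅-sup : ∀ r → ∃ λ v → BallVolume X r v × IsSup _≤_ (BallVolume X r) v
      V̅-sup r = supremum (BallVolume X r) (some r)
        -- Taking n = r is allowed because r < νʳ; the bound is crude, but it makes the supremum
        -- finite.
        λ (x , vol) → volume-upper {r} (ℕ.<⇒≤ (n<m^n ν r)) vol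
      V̲ V̅ : ℕ → ℕ
      V̲ r = proj₁ (V̲-inf r)
      V̅ r = proj₁ (V̅-sup r)

theorem8 : ExcludedMiddle (lsuc 0ℓ) →
    (X : Graph) (F : Pred (Graph.V X) 0ℓ) (ψ : Graph.V X → Graph.V X) →
    (hss : IsHomogeneouslySelfSimilar X F ψ) →
    BoundedGeometry X →
    (ν μ : ℕ) →
    (ν-scaling : IsLengthScalingFactor X F ν) →
    IsVolumeScalingFactor X F ψ μ →
    let instance ν≥2 = lengthScalingFactor-nonTrivial X F hss ν-scaling in
    IsLowerGlobalGrowthDimension X (log μ / log ν) ×
    IsUpperGlobalGrowthDimension X (log μ / log ν)
theorem8 em X F ψ hss (_ , deg≤b) ν μ ν-scaling μ-scaling =
  SelfSimilar.growth-dimension em X F ψ hss {{lengthScalingFactor-nonTrivial X F hss ν-scaling}}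
    ν-scaling μ-scaling deg≤b
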